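{- Let $p \neq 2$ be a prime, $n \geq 2$, and let $A$ be a cyclic permutation group of order $p^n$ on a finite set. For $i \in \{1,\ldots,n\}$ let $k_i$ denote the number of orbits of $A$ of cardinality $p^i$. Then: (1) if $\sum_{i=1}^n k_i = 1$, then $A \notin GR$; (2) if $\sum_{i=1}^n k_i = 2$, then $A \in GR^*(3)$ when $k_1 \in \{1,2\}$ and $p \in \{3,5\}$, and $A \in GR(2)$ otherwise; (3) if $\sum_{i=1}^n k_i > 2$, then $A \in GR(2)$.
   Context: A cyclic permutation group is a permutation group generated by a single permutation; its order is the number of its elements. A $k$-colored graph $G=(V,E)$ consists of a finite set $V$ and a function $E$ from the 2-element subsets of $V$ to $\{0,\ldots,k-1\}$. An automorphism of $G$ is a permutation of $V$ preserving $E$; $Aut(G)$ is the automorphism group as a permutation group on $V$. $GR(k)$ is the class of permutation groups $(A,V)$ with $A=Aut(G)$ for some $k$-colored graph $G$ on $V$; $GR=\bigcup_k GR(k)$; $GR^*(k)=GR(k)\setminus GR(k-1)$. -}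

module Defs where

open import Data.Nat using (ℕ; zero; suc; _+_; _<_; _≤_)
open import Data.Fin using (Fin)
open import Data.Fin.Permutation using (Permutation′; _⟨$⟩ʳ_)
open import Data.Product using (Σ; ∃; _×_)
open import Relation.Binary.PropositionalEquality using (_≡_; _≢_)
open import Relation.Nullary using (¬_)
open import Function.Bundles using (_⇔_)

pow : ∀ {m} → Permutation′ m → ℕ → Fin m → Fin m
pow σ zero    x = x
pow σ (suc j) x = σ ⟨$⟩ʳ (pow σ j x)

_≈ₚ_ : ∀ {m} → Permutation′ m → Permutation′ m → Set
π ≈ₚ ρ = ∀ x → π ⟨$⟩ʳ x ≡ ρ ⟨$⟩ʳ x

InCyclic : ∀ {m} → Permutation′ m → Permutation′ m → Set
InCyclic σ π = ∃ λ j → ∀ x → π ⟨$⟩ʳ x ≡ pow σ j x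

CyclicOrder : ∀ {m} → Permutation′ m → ℕ → Set
CyclicOrder {m} σ N =
  Σ (Fin N → Permutation′ m) λ f →
    (∀ i → InCyclic σ (f i)) ×
    (∀ i j → f i ≈ₚ f j → i ≡ j) ×
    (∀ π → InCyclic σ π → ∃ λ i → π ≈ₚ f i)

InOrbit : ∀ {m} → Permutation′ m → Fin m → Fin m → Set
InOrbit σ x y = ∃ λ j → y ≡ pow σ j x

OrbitSize : ∀ {m} → Permutation′ m → Fin m → ℕ → Set
OrbitSize {m} σ x s =
  Σ (Fin s → Fin m) λ f →
    (∀ i j → f i ≡ f j → i ≡ j) ×
    (∀ i → InOrbit σ x (f i)) ×
    (∀ y → InOrbit σ x y → ∃ λ i → y ≡ f i)

NumOrbitsOfSize : ∀ {m} → Permutation′ m → ℕ → ℕ → Set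
NumOrbitsOfSize {m} σ s k =
  Σ (Fin k → Fin m) λ r →
    (∀ i → OrbitSize σ (r i) s) ×
    (∀ i j → InOrbit σ (r i) (r j) → i ≡ j) ×
    (∀ y → OrbitSize σ y s → ∃ λ i → InOrbit σ (r i) y)

-- a k-colored graph on Fin m: a colouring of 2-subsets {x,y}, encoded as a
-- symmetric function whose diagonal values are ignored
record ColoredGraph (k m : ℕ) : Set where
  field
    col : Fin m → Fin m → Fin k
    sym : ∀ x y → col x y ≡ col y x

IsAut : ∀ {k m} → ColoredGraph k m → Permutation′ m → Set
IsAut G π = ∀ x y → x ≢ y → col (π ⟨$⟩ʳ x) (π ⟨$⟩ʳ y) ≡ col x y
  where open ColoredGraph G

InGR : ∀ {m} → ℕ → Permutation′ m → Set
InGR {m} k σ = Σ (ColoredGraph k m) λ G → ∀ π → IsAut G π ⇔ InCyclic σ π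

InGRany : ∀ {m} → Permutation′ m → Set
InGRany σ = ∃ λ k → InGR k σ

InGRstar : ∀ {m} → ℕ → Permutation′ m → Set
InGRstar zero    σ = InGR zero σ
InGRstar (suc k) σ = InGR (suc k) σ × ¬ InGR k σ

sum1to : (ℕ → ℕ) → ℕ → ℕ
sum1to k zero    = 0
sum1to k (suc n) = sum1to k n + k (suc n)

{-# OPTIONS --safe #-}

-- Let b be an orbit of size N = pⁿ. Inside b the graph joins points at cyclic distance at most N/4. Two points
-- are cyclic neighbours iff at most two others are joined to exactly one of them, so automorphisms act on b as
-- elements of the dihedral group. The other orbits a₁, a₂, … are taken by increasing size, fixed points last, with
-- colours εⱼ alternating in j: a pair (u, v) with v ∈ aⱼ and u in b or an earlier orbit has the colour opposite to
-- εⱼ, except that v has colour εⱼ to the points of b that it is synchronised with (congruent modulo |aⱼ|). A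
-- vertex of aⱼ has then fewer neighbours of colour εⱼ in b ∪ a₁ ∪ … ∪ aⱼ than any vertex of b ∪ a₁ ∪ … ∪ aⱼ₋₁, so
-- that automorphisms preserve every orbit, and by synchronisation they are determined on all orbits by their
-- action on b.
-- It remains to exclude reflections. With at least three nontrivial orbits this is done by synchronising a₂ with a₁
-- with a shift by one; with two of them, by joining v ∈ a₁ to its translates by 0, 1, 3 if |a₁| ≥ 7, and by giving
-- the translate by 1 a third colour otherwise.
-- Conversely, if there is one nontrivial orbit, a reflection of it preserves every invariant colouring. If |a₁| is
-- 3 or 5, every subset of ℤ/|a₁| is symmetric under some reflection, and two colours do not suffice.

module Submission where

open import Defs
open import Data.Bool using (Bool; true; false; not)
open import Data.Bool.Properties using (not-¬; not-involutive; ¬-not)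
import Data.Bool.Properties as Bool
open import Data.Empty using (⊥)
open import Data.Fin using (Fin; zero; suc; toℕ; fromℕ<; inject≤; combine)
open import Data.Fin.Permutation using (Permutation′; _⟨$⟩ʳ_; _⟨$⟩ˡ_; inverseˡ; inverseʳ; permutation; id; _∘ₚ_)
open import Data.Fin.Properties using (toℕ<n; toℕ-fromℕ<; toℕ-injective; fromℕ<-injective; inject≤-injective;
  combine-injective; injective⇒≤; pigeonhole; all?; any?)
import Data.Fin.Properties as Fin
open import Data.List using (List; []; _∷_; _++_; length; tabulate; filter; allFin)
open import Data.List.Properties using (length-++; length-tabulate)
open import Data.List.Membership.Propositional.Properties using (∈-filter⁺; ∈-allFin)
open import Data.List.Relation.Unary.All as All using (All; []; _∷_)
import Data.List.Relation.Unary.All.Properties as All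
open import Data.List.Relation.Unary.AllPairs as AllPairs using (AllPairs; []; _∷_)
import Data.List.Relation.Unary.AllPairs.Properties as AllPairs
open import Data.List.Relation.Unary.Any as Any using (Any; here; there)
import Data.List.Relation.Unary.Any.Properties as Any
import Data.List.Relation.Unary.Unique.Propositional.Properties as Unique
open import Data.Nat
open import Data.Nat.Coprimality using (Coprime; coprime-divisor)
open import Data.Nat.DivMod using (m%n<n; m≡m%n+[m/n]*n; /-monoˡ-≤)
open import Data.Nat.Divisibility
open import Data.Nat.Primality using (Prime; prime?; prime[2]; euclidsLemma; prime⇒irreducible; prime⇒nonZero; prime⇒nonTrivial)
open import Data.Nat.Properties
open import Data.Nat.Tactic.RingSolver using (solve-∀)
open import Data.Product using (_,_; _×_; ∃; Σ; proj₁; proj₂)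
open import Data.Sum using (_⊎_; inj₁; inj₂; [_,_]′; swap)
open import Data.Vec using ([]; _∷_; lookup)
open import Data.Vec.Properties using (lookup∘tabulate)
open import Function using (_∘_)
open import Function.Bundles using (mk⇔; module Equivalence)
open import Relation.Binary.Definitions using (tri<; tri≈; tri>)
open import Relation.Binary.PropositionalEquality
open import Relation.Nullary using (¬_; contradiction; yes; no; Dec; does)
open import Relation.Nullary.Decidable using (dec-true; dec-false; _⊎-dec_; _×-dec_; _→-dec_; does-⇔; from-yes; from-no)

-- Powers of a permutation and orbit coordinates

-- The counting has ample room only in the main orbit. With K = ⌊N/4⌋ and N odd, 4K < N ≤ 4K + 3, so
-- each vertex of b has at least 2K neighbours of either colour in b, while a vertex of aⱼ is
-- synchronised with N/|aⱼ| ≤ N/3 < 2K vertices. Between aᵢ and aⱼ, i < j, there is no such room: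
-- the sizes may be equal, and then the synchronised vertices only give a tie. The alternation of
-- the colours breaks it. If εᵢ = εⱼ, ordinary pairs between aᵢ and aᵢ₊₁ have the colour εⱼ; if εᵢ ≠
-- εⱼ, the pairs inside aᵢ have it. Excluding reflections with two orbits and two colours requires a
-- set of residues modulo q = |a₁| without reflection symmetry. Two residues are symmetric about
-- their midpoint, so three are taken; the cyclic gaps 1, 2, q - 3 of 0, 1, 3 are distinct for q ≥
-- 7. This triples the number of synchronised vertices, and 3N/q < 2K has to be secured: for q ≥ 9
-- directly, for q = p ≥ 7 because N ≥ p² is large.

module _ {m} (σ : Permutation′ m) where

  perm-injective : ∀ {x y} → σ ⟨$⟩ʳ x ≡ σ ⟨$⟩ʳ y → x ≡ y
  perm-injective e = trans (sym (inverseˡ σ)) (trans (cong (σ ⟨$⟩ˡ_) e) (inverseˡ σ))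

  pow-+ : ∀ a b x → pow σ (a + b) x ≡ pow σ a (pow σ b x)
  pow-+ zero    b x = refl
  pow-+ (suc a) b x = cong (σ ⟨$⟩ʳ_) (pow-+ a b x)

  pow-comm : ∀ a b x → pow σ a (pow σ b x) ≡ pow σ b (pow σ a x)
  pow-comm a b x = trans (sym (pow-+ a b x)) (trans (cong (λ t → pow σ t x) (+-comm a b)) (pow-+ b a x))

  pow-sucʳ : ∀ a x → pow σ (suc a) x ≡ pow σ a (σ ⟨$⟩ʳ x)
  pow-sucʳ a x = pow-comm 1 a x

  pow-injective : ∀ a {x y} → pow σ a x ≡ pow σ a y → x ≡ y
  pow-injective zero    e = e
  pow-injective (suc a) e = pow-injective a (perm-injective e)

  pow-*-fix : ∀ k {q x} → pow σ q x ≡ x → pow σ (k * q) x ≡ x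
  pow-*-fix zero    e = refl
  pow-*-fix (suc k) {q} {x} e = trans (pow-+ q (k * q) x) (trans (cong (pow σ q) (pow-*-fix k e)) e)

  pow-∣-fix : ∀ {q d x} → q ∣ d → pow σ q x ≡ x → pow σ d x ≡ x
  pow-∣-fix (divides k refl) = pow-*-fix k

  pow-% : ∀ t q .{{_ : NonZero q}} {x} → pow σ q x ≡ x → pow σ t x ≡ pow σ (t % q) x
  pow-% t q {x} e = trans (cong (λ s → pow σ s x) (m≡m%n+[m/n]*n t q))
    (trans (pow-+ (t % q) (t / q * q) x) (cong (pow σ (t % q)) (pow-*-fix (t / q) e)))

  pow-cancel : ∀ {s t x} → s ≤ t → pow σ s x ≡ pow σ t x → pow σ (t ∸ s) x ≡ x
  pow-cancel {s} {t} {x} s≤t e = pow-injective s (trans (sym (pow-+ s (t ∸ s) x))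
    (trans (cong (λ r → pow σ r x) (m+[n∸m]≡n s≤t)) (sym e)))

  fix-pow : ∀ d a x → pow σ d x ≡ x → pow σ d (pow σ a x) ≡ pow σ a x
  fix-pow d a x e = trans (pow-comm d a x) (cong (pow σ a) e)

  fix-pow⁻ : ∀ d a x → pow σ d (pow σ a x) ≡ pow σ a x → pow σ d x ≡ x
  fix-pow⁻ d a x e = pow-injective a (trans (pow-comm a d x) e)

-- Ranks run from 0 to `R`; rank 0 is the main orbit, and each rank above `T` is a single fixed
-- point. `q-chain` starts at rank 1 because the largest orbit stands in front of the smaller ones.
-- Exponents are arbitrary naturals; `period` and `minimal` express that they matter modulo `q i`.
record OrbitSystem {m} (σ : Permutation′ m) : Set where
  field
    R T      : ℕ
    q        : ℕ → ℕ
    rep      : ℕ → Fin m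
    ρ c      : Fin m → ℕ
    vtx-c    : ∀ u → pow σ (c u) (rep (ρ u)) ≡ u
    c<q      : ∀ u → c u < q (ρ u)
    ρ≤R      : ∀ u → ρ u ≤ R
    ρ-vtx    : ∀ {i} t → i ≤ R → ρ (pow σ t (rep i)) ≡ i
    period   : ∀ {i} → i ≤ R → pow σ (q i) (rep i) ≡ rep i
    minimal  : ∀ {i} d → i ≤ R → pow σ d (rep i) ≡ rep i → q i ∣ d
    T≤R      : T ≤ R
    q-fixed  : ∀ {i} → T < i → i ≤ R → q i ≡ 1
    q-chain  : ∀ {i j} → 1 ≤ i → i ≤ j → j ≤ T → q i ∣ q j
    q-top    : ∀ {i} → i ≤ R → q i ∣ q 0
    3≤q      : ∀ {i} → i ≤ T → 3 ≤ q i

  N : ℕ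
  N = q 0

  vtx : ℕ → ℕ → Fin m
  vtx i t = pow σ t (rep i)

  shift : ∀ s i t → pow σ s (vtx i t) ≡ vtx i (s + t)
  shift s i t = sym (pow-+ σ s t (rep i))

  ρ-pow : ∀ t u → ρ (pow σ t u) ≡ ρ u
  ρ-pow t u = trans (cong (λ v → ρ (pow σ t v)) (sym (vtx-c u)))
    (trans (cong ρ (shift t (ρ u) (c u))) (ρ-vtx (t + c u) (ρ≤R u)))

  ρ-σ : ∀ u → ρ (σ ⟨$⟩ʳ u) ≡ ρ u
  ρ-σ = ρ-pow 1

  fix⇒∣ : ∀ d u → pow σ d u ≡ u → q (ρ u) ∣ d
  fix⇒∣ d u e = minimal d (ρ≤R u) (fix-pow⁻ σ d (c u) _
    (trans (cong (pow σ d) (vtx-c u)) (trans e (sym (vtx-c u)))))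

  ∣⇒fix : ∀ d u → q (ρ u) ∣ d → pow σ d u ≡ u
  ∣⇒fix d u q∣d = trans (cong (pow σ d) (sym (vtx-c u))) (trans
    (fix-pow σ d (c u) _ (pow-∣-fix σ q∣d (period (ρ≤R u)))) (vtx-c u))

  free : ∀ d u → 0 < d → d < q (ρ u) → pow σ d u ≢ u
  free (suc d) u _ d<q e = ≤⇒≯ (∣⇒≤ (fix⇒∣ _ u e)) d<q

  powN : ∀ u → pow σ N u ≡ u
  powN u = ∣⇒fix N u (q-top (ρ≤R u))

  private
    exp-inj-≤ : ∀ {a b} u → a ≤ b → b < q (ρ u) → pow σ a u ≡ pow σ b u → a ≡ b
    exp-inj-≤ {a} {b} u a≤b b<q e with m≤n⇒m<n∨m≡n a≤b
    ... | inj₂ eq = eq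
    ... | inj₁ a<b = contradiction (pow-cancel σ a≤b e)
                       (free (b ∸ a) u (m<n⇒0<n∸m a<b) (≤-<-trans (m∸n≤m b a) b<q))

  exp-injective : ∀ {a b} u → a < q (ρ u) → b < q (ρ u) → pow σ a u ≡ pow σ b u → a ≡ b
  exp-injective {a} {b} u a<q b<q e with ≤-total a b
  ... | inj₁ a≤b = exp-inj-≤ u a≤b b<q e
  ... | inj₂ b≤a = sym (exp-inj-≤ u b≤a a<q (sym e))

  private
    vtx-transport-≤ : ∀ {i j s t} → i ≤ R → j ≤ R → q j ∣ q i → s ≤ t → vtx i s ≡ vtx i t → vtx j s ≡ vtx j t
    vtx-transport-≤ {i} {j} {s} {t} i≤R j≤R d s≤t e =
      trans (sym (cong (pow σ s) (pow-∣-fix σ (∣-trans d (minimal (t ∸ s) i≤R (pow-cancel σ s≤t e))) (period j≤R))))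
        (trans (shift s j (t ∸ s)) (cong (vtx j) (m+[n∸m]≡n s≤t)))

  -- Exponents of equal vertices differ by a multiple of `q i`, hence of its divisor `q j`. This
  -- makes `π` independent of the exponent chosen.
  vtx-transport : ∀ {i j s t} → i ≤ R → j ≤ R → q j ∣ q i → vtx i s ≡ vtx i t → vtx j s ≡ vtx j t
  vtx-transport {s = s} {t} i≤R j≤R d e with ≤-total s t
  ... | inj₁ s≤t = vtx-transport-≤ i≤R j≤R d s≤t e
  ... | inj₂ t≤s = sym (vtx-transport-≤ i≤R j≤R d t≤s (sym e))

  -- The reduction of ℤ/q(ρ u) to ℤ/q(j) in coordinates. It commutes with `σ` when `q j` divides
  -- `q (ρ u)`, in particular on the main orbit.
  π : ℕ → Fin m → Fin m
  π j u = vtx j (c u)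

  ρ-π : ∀ {j} u → j ≤ R → ρ (π j u) ≡ j
  ρ-π u j≤R = ρ-vtx (c u) j≤R

  π-vtx : ∀ {i j} t → i ≤ R → j ≤ R → q j ∣ q i → π j (vtx i t) ≡ vtx j t
  π-vtx {i} {j} t i≤R j≤R d = vtx-transport {s = c (vtx i t)} {t} i≤R j≤R d
    (trans (cong (λ k → vtx k (c (vtx i t))) (sym (ρ-vtx t i≤R))) (vtx-c (vtx i t)))

  π-pow : ∀ {j} t u → j ≤ R → q j ∣ q (ρ u) → π j (pow σ t u) ≡ pow σ t (π j u)
  π-pow {j} t u j≤R d = trans (cong (λ v → π j (pow σ t v)) (sym (vtx-c u)))
    (trans (cong (π j) (shift t (ρ u) (c u)))
    (trans (π-vtx (t + c u) (ρ≤R u) j≤R d) (sym (shift t j (c u)))))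

  π-π : ∀ {i j} u → i ≤ R → j ≤ R → q i ∣ q j → π i (π j u) ≡ π i u
  π-π u i≤R j≤R d = π-vtx (c u) j≤R i≤R d

  lift : Fin m → Fin m
  lift u = vtx 0 (c u)

  ρ-lift : ∀ u → ρ (lift u) ≡ 0
  ρ-lift u = ρ-vtx (c u) z≤n

  π-lift : ∀ {j} u → ρ u ≡ j → π j (lift u) ≡ u
  π-lift u refl = trans (π-vtx (c u) z≤n (ρ≤R u) (q-top (ρ≤R u))) (vtx-c u)

  fixed : ∀ u → T < ρ u → σ ⟨$⟩ʳ u ≡ u
  fixed u T<ρ = ∣⇒fix 1 u (subst (_∣ 1) (sym (q-fixed T<ρ (ρ≤R u))) ∣-refl)

  fixed-unique : ∀ {u v} → T < ρ u → ρ u ≡ ρ v → u ≡ v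
  fixed-unique {u} {v} T<ρ e = trans (sym (vtx-c u)) (trans (cong₂ vtx e (trans (c≡0 u T<ρ)
      (sym (c≡0 v (subst (T <_) e T<ρ))))) (vtx-c v))
    where
    c≡0 : ∀ w → T < ρ w → c w ≡ 0
    c≡0 w T<w = n<1⇒n≡0 (subst (c w <_) (q-fixed T<w (ρ≤R w)) (c<q w))

-- Automorphisms of layered graphs

-- Bounds as injections from and into `Fin w`, so that no set has to be enumerated exactly. In
-- `AtMost` the index may depend on the membership proof, and injectivity ranges over all proofs.
AtLeast AtMost : ∀ {m} → ℕ → (Fin m → Set) → Set
AtLeast {m} w P = Σ (Fin w → Fin m) λ g → (∀ i j → g i ≡ g j → i ≡ j) × (∀ i → P (g i))
AtMost {m} w P = Σ (∀ v → P v → Fin w) λ ι → ∀ v v′ h h′ → ι v h ≡ ι v′ h′ → v ≡ v′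

atLeast-atMost : ∀ {m w} {P : Fin m → Set} → AtLeast (suc w) P → AtMost w P → ⊥
atLeast-atMost {w = w} (g , g-inj , gP) (ι , ι-inj) =
  let i , j , i<j , e = pigeonhole (n<1+n w) (λ i → ι (g i) (gP i))
  in <⇒≢ i<j (cong toℕ (g-inj i j (ι-inj _ _ _ _ e)))

atLeast-map : ∀ {m w} {P Q : Fin m → Set} (h : Fin m → Fin m) → (∀ {x y} → h x ≡ h y → x ≡ y) →
  (∀ {v} → P v → Q (h v)) → AtLeast w P → AtLeast w Q
atLeast-map h h-inj PQ (g , g-inj , gP) = h ∘ g , (λ i j → g-inj i j ∘ h-inj) , PQ ∘ gP

atLeast-≤ : ∀ {m w w′} {P : Fin m → Set} → w ≤ w′ → AtLeast w′ P → AtLeast w P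
atLeast-≤ w≤ (g , g-inj , gP) = g ∘ inj , (λ i j e → inject≤-injective w≤ w≤ i j (g-inj _ _ e)) , gP ∘ inj
  where
  inj = λ i → inject≤ i w≤

atLeast-suc : ∀ {m w} {P Q : Fin m → Set} → (∀ {v} → P v → Q v) → AtLeast w P →
  ∀ v → Q v → ¬ P v → AtLeast (suc w) Q
atLeast-suc {m} {w} {P} {Q} PQ (g , g-inj , gP) v Qv ¬Pv = h , h-inj , hQ
  where
  h : Fin (suc w) → Fin m
  h zero    = v
  h (suc i) = g i
  h-inj : ∀ i j → h i ≡ h j → i ≡ j
  h-inj zero    zero    e = refl
  h-inj zero    (suc j) e = contradiction (subst P (sym e) (gP j)) ¬Pv
  h-inj (suc i) zero    e = contradiction (subst P e (gP i)) ¬Pv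
  h-inj (suc i) (suc j) e = cong suc (g-inj i j e)
  hQ : ∀ i → Q (h i)
  hQ zero    = Qv
  hQ (suc i) = PQ (gP i)

atMost-map : ∀ {m w} {P Q : Fin m → Set} → (∀ {v} → P v → Q v) → AtMost w Q → AtMost w P
atMost-map PQ (ι , ι-inj) = (λ v → ι v ∘ PQ) , λ v v′ h h′ → ι-inj v v′ (PQ h) (PQ h′)

atMost-⋃ : ∀ {m w D} {P : Fin D → Fin m → Set} → (∀ i → AtMost w (P i)) → AtMost (D * w) (λ v → ∃ λ i → P i v)
atMost-⋃ {P = P} most = (λ v (i , h) → combine i (proj₁ (most i) v h)) , inj
  where
  inj : ∀ v v′ h h′ → _ → v ≡ v′
  inj v v′ (i , h) (i′ , h′) e with combine-injective i _ i′ _ e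
  ... | refl , e′ = proj₂ (most i) v v′ h h′ e′

atMost-suc : ∀ {m w} {P Q : Fin m → Set} → AtMost w P → (∀ v v′ → Q v → Q v′ → v ≡ v′) → AtMost (suc w) (λ v → P v ⊎ Q v)
atMost-suc {m} {w} {P} {Q} (ι , ι-inj) unique = κ , κ-inj
  where
  κ : ∀ v → P v ⊎ Q v → Fin (suc w)
  κ v (inj₁ h) = Fin.suc (ι v h)
  κ v (inj₂ h) = Fin.zero
  κ-inj : ∀ v v′ h h′ → κ v h ≡ κ v′ h′ → v ≡ v′
  κ-inj v v′ (inj₁ h) (inj₁ h′) e = ι-inj v v′ h h′ (Fin.suc-injective e)
  κ-inj v v′ (inj₂ h) (inj₂ h′) e = unique v v′ h h′

atLeast-1 : ∀ {m} {P : Fin m → Set} v → P v → AtLeast 1 P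
atLeast-1 v Pv = (λ _ → v) , (λ { Fin.zero Fin.zero _ → refl }) , λ _ → Pv

record Automorphism {m} (E : Fin m → Fin m → Bool) : Set where
  field
    to from : Fin m → Fin m
    to-from : ∀ u → to (from u) ≡ u
    from-to : ∀ u → from (to u) ≡ u
    to-pres : ∀ u v → u ≢ v → E (to u) (to v) ≡ E u v

  to-injective : ∀ {u v} → to u ≡ to v → u ≡ v
  to-injective e = trans (sym (from-to _)) (trans (cong from e) (from-to _))

  from-injective : ∀ {u v} → from u ≡ from v → u ≡ v
  from-injective e = trans (sym (to-from _)) (trans (cong to e) (to-from _))

  from-pres : ∀ u v → u ≢ v → E (from u) (from v) ≡ E u v
  from-pres u v u≢v = trans (sym (to-pres (from u) (from v) (u≢v ∘ from-injective)))
    (cong₂ E (to-from u) (to-from v))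

  inverse : Automorphism E
  inverse = record { to = from ; from = to ; to-from = from-to ; from-to = to-from ; to-pres = from-pres }

  from-pres′ : ∀ u v → to u ≢ v → E u (from v) ≡ E (to u) v
  from-pres′ u v tu≢v = trans (cong (λ x → E x (from v)) (sym (from-to u))) (from-pres (to u) v tu≢v)

-- In the top layer each vertex has at most w neighbours of colour ε, in the lower layers it has more:
-- an automorphism preserves the top layer, and then, after its removal, the next one.
module Peeling {m} (E : Fin m → Fin m → Bool) (ρ : Fin m → ℕ) (ε : ℕ → Bool) (R : ℕ) where

  Nb : ℕ → Fin m → Fin m → Set
  Nb j u v = u ≢ v × ρ v ≤ j × E u v ≡ ε j

  Peelable : ℕ → Set
  Peelable j = ∃ λ w → (∀ u → ρ u ≡ j → AtMost w (Nb j u)) × (∀ u → ρ u < j → AtLeast (suc w) (Nb j u))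

  module _ (peel : ∀ j → 1 ≤ j → j ≤ R → Peelable j) (ρ≤R : ∀ u → ρ u ≤ R) where
    open Automorphism

    PreservesAbove : ℕ → Set
    PreservesAbove j = (A : Automorphism E) → ∀ u → j < ρ u → ρ (to A u) ≡ ρ u

    -- If the image lay above `j`, the inverse, which preserves ranks above `j`, would return it to
    -- a vertex above `j`.
    stays-below : ∀ {j} → PreservesAbove j → (A : Automorphism E) → ∀ u → ρ u ≤ j → ρ (to A u) ≤ j
    stays-below {j} H A u u≤j with ρ (to A u) ≤? j
    ... | yes p = p
    ... | no ¬p = contradiction (subst (_≤ j) (trans (cong ρ (sym (from-to A u))) (H (inverse A) (to A u) (≰⇒> ¬p))) u≤j) ¬p

    -- If a vertex of layer `suc j` dropped to a lower layer, its image would have more than `w`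
    -- neighbours of the layer's colour; the inverse carries them back to neighbours of the vertex
    -- itself, still within the layers up to `suc j`.
    step : ∀ j → suc j ≤ R → PreservesAbove (suc j) → PreservesAbove j
    step j j<R H A u j<u with m≤n⇒m<n∨m≡n j<u
    ... | inj₁ sj<u = H A u sj<u
    ... | inj₂ eq with m≤n⇒m<n∨m≡n (stays-below H A u (≤-reflexive (sym eq)))
    ... | inj₂ e = trans e eq
    ... | inj₁ lower with peel (suc j) (s≤s z≤n) j<R
    ... | w , most , least = contradiction (most u (sym eq)) λ am → atLeast-atMost {P = Nb (suc j) u}
          (atLeast-map {P = Nb (suc j) (to A u)} {Q = Nb (suc j) u} (from A) (from-injective A)
            (λ {v} (u≢v , v≤ , col) → (λ e → u≢v (trans (cong (to A) e) (to-from A v))) ,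
               stays-below H (inverse A) v v≤ , trans (from-pres′ A u v u≢v) col)
            (least (to A u) lower)) am

    preserves-above : ∀ d j → d + j ≡ R → PreservesAbove j
    preserves-above zero    j refl A u R<u = contradiction (ρ≤R u) (<⇒≱ R<u)
    preserves-above (suc d) j e = step j (subst (suc j ≤_) e (s≤s (m≤n+m j d)))
      (preserves-above d (suc j) (trans (+-suc d j) e))

    preserves-rank : (A : Automorphism E) → ∀ u → ρ (to A u) ≡ ρ u
    preserves-rank A u with ρ u in eq
    ... | zero  = n≤0⇒n≡0 (stays-below (preserves-above R 0 (+-identityʳ R)) A u (≤-reflexive eq))
    ... | suc r = trans (preserves-above R 0 (+-identityʳ R) A u (subst (0 <_) (sym eq) (s≤s z≤n))) eq

-- The graph on the main orbit

module Circulant {m} {σ : Permutation′ m} (S : OrbitSystem σ) (K : ℕ)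
  (2≤K : 2 ≤ K) (4K<N : 4 * K < OrbitSystem.N S) where

  open OrbitSystem S

  Near : Fin m → Fin m → Set
  Near u v = ∃ λ (d : Fin K) → pow σ (suc (toℕ d)) u ≡ v ⊎ pow σ (suc (toℕ d)) v ≡ u

  near? : ∀ u v → Dec (Near u v)
  near? u v = any? λ d → (_ Fin.≟ _) ⊎-dec (_ Fin.≟ _)

  near-sym : ∀ {u v} → Near u v → Near v u
  near-sym (d , e) = d , swap e

  2K+2K<N : (K + K) + (K + K) < N
  2K+2K<N = subst (_< N) (trans (cong (λ x → K + (K + (K + x))) (+-identityʳ K)) (sym (+-assoc K K (K + K)))) 4K<N

  2K<N : K + K < N
  2K<N = ≤-<-trans (m≤m+n (K + K) (K + K)) 2K+2K<N

  K<N : K < N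
  K<N = ≤-<-trans (m≤m+n K K) 2K<N

  instance
    N≢0 : NonZero N
    N≢0 = >-nonZero (≤-<-trans z≤n K<N)

  near-low : ∀ {a u} → 1 ≤ a → a ≤ K → Near u (pow σ a u)
  near-low {suc a} {u} _ a<K = fromℕ< a<K , inj₁ (cong (λ t → pow σ (suc t) u) (toℕ-fromℕ< a<K))

  near-high : ∀ {a u} → a < N → N ≤ K + a → Near u (pow σ a u)
  near-high {a} {u} a<N N≤ = subst (λ w → Near w (pow σ a u))
    (trans (sym (pow-+ σ (N ∸ a) a u)) (trans (cong (λ t → pow σ t u) (m∸n+n≡m (<⇒≤ a<N))) (powN u)))
    (near-sym (near-low (m<n⇒0<n∸m a<N) (m≤n+o⇒m∸n≤o N a (subst (N ≤_) (+-comm K a) N≤))))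

  -- The two inequalities keep the distance above `K` in the two directions around the cycle.
  not-near : ∀ {a u} → ρ u ≡ 0 → K < a → K + a < N → ¬ Near u (pow σ a u)
  not-near {a} {u} ρu K<a K+a<N (d , inj₁ e) = <⇒≢ (≤-<-trans (toℕ<n d) K<a)
    (exp-injective u (subst (suc (toℕ d) <_) (cong q (sym ρu)) (≤-<-trans (toℕ<n d) K<N))
      (subst (a <_) (cong q (sym ρu)) (≤-<-trans (m≤n+m a K) K+a<N)) e)
  not-near {a} {u} ρu K<a K+a<N (d , inj₂ e) = free (suc (toℕ d) + a) u (s≤s z≤n)
    (subst (suc (toℕ d) + a <_) (cong q (sym ρu)) (≤-<-trans (+-monoˡ-≤ a (toℕ<n d)) K+a<N))
    (trans (pow-+ σ (suc (toℕ d)) a u) e)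

  reach : ∀ {u v} → ρ u ≡ 0 → ρ v ≡ 0 → ∃ λ t → t < N × v ≡ pow σ t u
  reach {u} {v} ρu ρv = s % N , m%n<n s N , sym (trans (sym (pow-% σ s N (powN u))) to-v)
    where
    -- `N ∸ c u` stands for minus `c u`: back to the representative, then on to `v`.
    s = c v + (N ∸ c u)
    c<N : c u ≤ N
    c<N = <⇒≤ (subst (c u <_) (cong q ρu) (c<q u))
    to-v : pow σ s u ≡ v
    to-v = begin
      pow σ s u                         ≡⟨ cong (pow σ s) (trans (sym (vtx-c u)) (cong (λ i → vtx i (c u)) ρu)) ⟩
      pow σ s (vtx 0 (c u))             ≡⟨ shift s 0 (c u) ⟩
      vtx 0 (c v + (N ∸ c u) + c u)     ≡⟨ cong (vtx 0) (trans (+-assoc (c v) _ _) (cong (c v +_) (m∸n+n≡m c<N))) ⟩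
      vtx 0 (c v + N)                   ≡⟨ pow-+ σ (c v) N (rep 0) ⟩
      pow σ (c v) (pow σ N (rep 0))     ≡⟨ cong (pow σ (c v)) (powN (rep 0)) ⟩
      vtx 0 (c v)                       ≡⟨ cong (λ i → vtx i (c v)) (sym ρv) ⟩
      vtx (ρ v) (c v)                   ≡⟨ vtx-c v ⟩
      v                                 ∎
      where open ≡-Reasoning

  distinct : ∀ {a b u} → ρ u ≡ 0 → a < b → b < N → pow σ a u ≢ pow σ b u
  distinct {a} {b} {u} ρu a<b b<N e = <⇒≢ a<b (exp-injective u
    (subst (a <_) (cong q (sym ρu)) (<-trans a<b b<N)) (subst (b <_) (cong q (sym ρu)) b<N) e)

  ρ-pow0 : ∀ t {u} → ρ u ≡ 0 → ρ (pow σ t u) ≡ 0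
  ρ-pow0 t {u} ρu = trans (ρ-pow t u) ρu

  module Rigidity (E : Fin m → Fin m → Bool)
    (E-main : ∀ {u v} → ρ u ≡ 0 → ρ v ≡ 0 → E u v ≡ does (near? u v))
    (A : Automorphism E) (rank : ∀ u → ρ (Automorphism.to A u) ≡ ρ u) where

    open Automorphism A

    E-near : ∀ {u v} → ρ u ≡ 0 → ρ v ≡ 0 → Near u v → E u v ≡ true
    E-near {u} {v} ρu ρv n = trans (E-main ρu ρv) (dec-true (near? u v) n)

    E-far : ∀ {u v} → ρ u ≡ 0 → ρ v ≡ 0 → ¬ Near u v → E u v ≡ false
    E-far {u} {v} ρu ρv n = trans (E-main ρu ρv) (dec-false (near? u v) n)

    -- The points `y` and `z` are excluded because an automorphism preserves `E` only off the
    -- diagonal.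
    Separates : Fin m → Fin m → Fin m → Set
    Separates y z v = ρ v ≡ 0 × v ≢ y × v ≢ z × E y v ≢ E z v

    separates-sym : ∀ {y z v} → Separates y z v → Separates z y v
    separates-sym (r , a , b , n) = r , b , a , n ∘ sym

    separates-from : ∀ {x x′ v} → Separates (to x) (to x′) v → Separates x x′ (from v)
    separates-from {x} {x′} {v} (r , a , b , n) =
      trans (sym (rank (from v))) (trans (cong ρ (to-from v)) r) ,
      (λ e → a (trans (sym (to-from v)) (cong to e))) ,
      (λ e → b (trans (sym (to-from v)) (cong to e))) ,
      λ e → n (trans (sym (from-pres′ x v (a ∘ sym))) (trans e (from-pres′ x′ v (b ∘ sym))))

    -- When the centre of an interval of radius `K` moves by one step, only the ends change:
    -- `pow σ (suc K) x` enters and `pow σ (N ∸ K) x` leaves.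
    separators-of-adjacent : ∀ {x v} → ρ x ≡ 0 → Separates x (σ ⟨$⟩ʳ x) v →
      v ≡ pow σ (suc K) x ⊎ v ≡ pow σ (N ∸ K) x
    separators-of-adjacent {x} {v} ρx (ρv , v≢x , v≢σx , n) with reach ρx ρv
    ... | zero        , _   , refl = contradiction refl v≢x
    ... | suc zero    , _   , refl = contradiction refl v≢σx
    ... | suc (suc t) , t<N , refl = cases
      where
      ρσx : ρ (pow σ 1 x) ≡ 0
      ρσx = ρ-pow0 1 ρx
      v-from-σx : pow σ (suc t) (pow σ 1 x) ≡ pow σ (suc (suc t)) x
      v-from-σx = sym (pow-sucʳ σ (suc t) x)
      both-near : Near x (pow σ (suc (suc t)) x) → Near (pow σ 1 x) (pow σ (suc (suc t)) x) → _
      both-near a b = contradiction (trans (E-near ρx ρv a) (sym (E-near ρσx ρv b))) n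
      cases : _
      cases with <-cmp (suc t) K
      ... | tri< st<K _ _ = both-near (near-low (s≤s z≤n) st<K)
                              (subst (Near _) v-from-σx (near-low (s≤s z≤n) (<⇒≤ st<K)))
      ... | tri≈ _ refl _ = inj₁ refl
      ... | tri> _ _ K<st with <-cmp (K + suc (suc t)) N
      ... | tri≈ _ e _ = inj₂ (cong (λ s → pow σ s x) (trans (sym (m+n∸m≡n K (suc (suc t)))) (cong (_∸ K) e)))
      ... | tri< lt _ _ = contradiction (trans (E-far ρx ρv (not-near ρx (<-trans K<st (n<1+n (suc t))) lt))
              (sym (E-far ρσx ρv (λ nr → not-near ρσx K<st (<-trans (n<1+n _) (subst (_< N) (+-suc K (suc t)) lt))
                (subst (Near _) (sym v-from-σx) nr))))) n
      ... | tri> _ _ gt = both-near (near-high t<N (<⇒≤ gt))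
              (subst (Near _) v-from-σx (near-high (<⇒≤ t<N) (≤-pred (subst (suc N ≤_) (+-suc K (suc t)) gt))))

    record Three (P : Fin m → Set) : Set where
      field
        v₁ v₂ v₃ : Fin m
        P₁ : P v₁
        P₂ : P v₂
        P₃ : P v₃
        v₁≢v₂ : v₁ ≢ v₂
        v₁≢v₃ : v₁ ≢ v₃
        v₂≢v₃ : v₂ ≢ v₃

    three-map : ∀ {P Q : Fin m → Set} → (∀ {v} → P v → Q v) → Three P → Three Q
    three-map f t = record { v₁ = v₁ ; v₂ = v₂ ; v₃ = v₃ ; P₁ = f P₁ ; P₂ = f P₂ ; P₃ = f P₃
      ; v₁≢v₂ = v₁≢v₂ ; v₁≢v₃ = v₁≢v₃ ; v₂≢v₃ = v₂≢v₃ }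
      where open Three t

    -- Two neighbours x, σ x on the cycle are separated by two vertices only, any other pair by at least three;
    -- so an automorphism maps neighbours to neighbours.
    three-separators : ∀ {d y} → ρ y ≡ 0 → 2 ≤ d → d + d ≤ N → Three (Separates y (pow σ d y))
    three-separators {d} {y} ρy 2≤d 2d≤N = record
      -- Counted from `β`, the points `y` and `z` have positions `K` and `d + K`. Positions 0 and 1
      -- are near `y` but, as `d` is at least 2, not near `z`; the third separator lies `K` beyond
      -- `z`, too far from `y`.
      { v₁ = β ; v₂ = pow σ 1 β ; v₃ = pow σ (K + (d + K)) β
      ; P₁ = sep 0 ρβ (λ e → distinct ρβ (≤-trans (s≤s z≤n) 2≤K) K<N (trans e (sym y≡)))
                 (λ e → distinct ρβ (≤-trans (s≤s z≤n) (m≤n⇒m≤o+n d (≤-trans (n≤1+n 1) 2≤K))) d+K<N (trans e (sym z≡)))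
                 (near-at K 0 K y≡ (≤-trans (n≤1+n 1) 2≤K) ≤-refl (+-identityʳ K))
                 (far-at (d + K) 0 (d + K) z≡ (m<n+m K (≤-trans (s≤s z≤n) 2≤d)) K+[d+K]<N (+-identityʳ (d + K)))
      ; P₂ = sep 1 (ρ-pow0 1 ρβ) (λ e → distinct ρβ 2≤K K<N (trans e (sym y≡)))
                 (λ e → distinct ρβ (≤-trans 2≤d (m≤m+n d K)) d+K<N (trans e (sym z≡)))
                 (near-at K 1 (pred K) y≡ (pred-mono-≤ 2≤K) pred[n]≤n K-1+1)
                 (far-at (d + K) 1 (d + pred K) z≡ (subst (_≤ d + pred K) (cong suc K-1+1′) (+-monoˡ-≤ (pred K) 2≤d))
                    (≤-<-trans (+-monoʳ-≤ K (+-monoʳ-≤ d pred[n]≤n)) K+[d+K]<N) (trans (+-assoc d (pred K) 1) (cong (d +_) K-1+1)))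
      ; P₃ = ρ-pow0 (K + (d + K)) ρβ
           , (λ e → distinct ρβ (m<m+n K (≤-trans (s≤s z≤n) (≤-trans 2≤d (m≤m+n d K)))) K+[d+K]<N (sym (trans e (sym y≡))))
           , (λ e → distinct ρβ (m<n+m (d + K) (≤-trans (s≤s z≤n) 2≤K)) K+[d+K]<N (sym (trans e (sym z≡))))
           , λ e → true≢false (trans (sym (E-near ρz (ρ-pow0 (K + (d + K)) ρβ) (subst (Near z) v₃-from-z (near-low {K} {z} (≤-trans (n≤1+n 1) 2≤K) ≤-refl))))
               (trans (sym e) (E-far ρy (ρ-pow0 (K + (d + K)) ρβ) (λ nr → not-near {d + K} {y} ρy (m<n+m K (≤-trans (s≤s z≤n) 2≤d)) K+[d+K]<N
                  (subst (Near y) (sym v₃-from-y) nr)))))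
      ; v₁≢v₂ = distinct ρβ (s≤s z≤n) (≤-<-trans (≤-trans (n≤1+n 1) 2≤K) K<N)
      ; v₁≢v₃ = distinct ρβ (≤-trans (≤-trans (s≤s z≤n) 2≤K) (m≤m+n K (d + K))) K+[d+K]<N
      ; v₂≢v₃ = distinct ρβ (≤-trans 2≤K (m≤m+n K (d + K))) K+[d+K]<N }
      where
      β z : Fin m
      β = pow σ (N ∸ K) y
      z = pow σ d y
      ρβ : ρ β ≡ 0
      ρβ = ρ-pow0 (N ∸ K) ρy
      ρz : ρ z ≡ 0
      ρz = ρ-pow0 d ρy
      true≢false : true ≢ false
      true≢false ()
      y≡ : pow σ K β ≡ y
      y≡ = trans (sym (pow-+ σ K (N ∸ K) y)) (trans (cong (λ t → pow σ t y) (m+[n∸m]≡n (<⇒≤ K<N))) (powN y))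
      z≡ : pow σ (d + K) β ≡ z
      z≡ = trans (pow-+ σ d K β) (cong (pow σ d) y≡)
      v₃-from-z : pow σ K z ≡ pow σ (K + (d + K)) β
      v₃-from-z = trans (cong (pow σ K) (sym z≡)) (sym (pow-+ σ K (d + K) β))
      v₃-from-y : pow σ (d + K) y ≡ pow σ (K + (d + K)) β
      v₃-from-y = trans (cong (λ t → pow σ t y) (+-comm d K)) (trans (pow-+ σ K d y) v₃-from-z)
      K-1+1 : pred K + 1 ≡ K
      K-1+1 = trans (+-comm (pred K) 1) (suc-pred K {{>-nonZero (≤-trans (s≤s z≤n) 2≤K)}})
      K-1+1′ : suc (pred K) ≡ K
      K-1+1′ = trans (+-comm 1 (pred K)) K-1+1
      -- Twice the left side is `2d + 4K` with `2d ≤ N` and `4K < N`. This keeps distances above `K`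
      -- also when measured the other way round.
      K+[d+K]<N : K + (d + K) < N
      K+[d+K]<N = *-cancelˡ-< 2 _ _ (subst (_< 2 * N) (sym (eq K d)) (+-mono-≤-< 2d≤N (subst ((K + K) + (K + K) <_) (sym (+-identityʳ N)) 2K+2K<N)))
        where
        eq : ∀ a b → 2 * (a + (b + a)) ≡ (b + b) + ((a + a) + (a + a))
        eq = solve-∀
      d+K<N : d + K < N
      d+K<N = ≤-<-trans (m≤n+m (d + K) K) K+[d+K]<N
      near-at : ∀ b a e {w} → pow σ b β ≡ w → 1 ≤ e → e ≤ K → e + a ≡ b → Near (pow σ a β) w
      near-at b a e refl 1≤e e≤K refl = subst (Near (pow σ a β)) (sym (pow-+ σ e a β)) (near-low 1≤e e≤K)
      far-at : ∀ b a e {w} → pow σ b β ≡ w → K < e → K + e < N → e + a ≡ b → ¬ Near (pow σ a β) w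
      far-at b a e refl K<e K+e<N refl nr = not-near (ρ-pow0 a ρβ) K<e K+e<N (subst (Near (pow σ a β)) (pow-+ σ e a β) nr)
      sep : ∀ a → ρ (pow σ a β) ≡ 0 → pow σ a β ≢ y → pow σ a β ≢ z → Near (pow σ a β) y → ¬ Near (pow σ a β) z →
        Separates y z (pow σ a β)
      sep a ρa ≢y ≢z ny nz = ρa , ≢y , ≢z , λ e →
        true≢false (trans (sym (E-near ρy ρa (near-sym ny))) (trans e (E-far ρz ρa (nz ∘ near-sym))))

    at-most-two : ∀ {x} → ρ x ≡ 0 → ¬ Three (Separates (to x) (to (σ ⟨$⟩ʳ x)))
    at-most-two ρx t with separators-of-adjacent ρx (separates-from P₁) | separators-of-adjacent ρx (separates-from P₂)
                        | separators-of-adjacent ρx (separates-from P₃)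
      where open Three t
    ... | inj₁ a | inj₁ b | _      = Three.v₁≢v₂ t (from-injective (trans a (sym b)))
    ... | inj₂ a | inj₂ b | _      = Three.v₁≢v₂ t (from-injective (trans a (sym b)))
    ... | inj₁ a | inj₂ b | inj₁ d = Three.v₁≢v₃ t (from-injective (trans a (sym d)))
    ... | inj₁ a | inj₂ b | inj₂ d = Three.v₂≢v₃ t (from-injective (trans b (sym d)))
    ... | inj₂ a | inj₁ b | inj₁ d = Three.v₂≢v₃ t (from-injective (trans b (sym d)))
    ... | inj₂ a | inj₁ b | inj₂ d = Three.v₁≢v₃ t (from-injective (trans a (sym d)))

    Forward Backward : Fin m → Set
    Forward  x = to (σ ⟨$⟩ʳ x) ≡ σ ⟨$⟩ʳ (to x)
    Backward x = σ ⟨$⟩ʳ (to (σ ⟨$⟩ʳ x)) ≡ to x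

    ρ-to : ∀ {x} → ρ x ≡ 0 → ρ (to x) ≡ 0
    ρ-to {x} ρx = trans (rank x) ρx

    -- Three separators are available for arcs of at most half the cycle, so they are applied to the
    -- shorter of the two arcs between the images of `x` and `σ x`. Only distance one remains, in
    -- either direction.
    adjacent : ∀ {x} → ρ x ≡ 0 → Forward x ⊎ Backward x
    adjacent {x} ρx with reach {to x} {to (σ ⟨$⟩ʳ x)} (ρ-to ρx) (ρ-to (ρ-pow0 1 ρx))
    ... | zero        , _   , e = contradiction (to-injective (sym e)) (distinct {0} {1} ρx (s≤s z≤n) (≤-<-trans (≤-trans (n≤1+n 1) 2≤K) K<N))
    ... | suc zero    , _   , e = inj₁ e
    ... | suc (suc d) , d<N , e with m≤n⇒m<n∨m≡n d<N
    ... | inj₂ eq = inj₂ (trans (cong (σ ⟨$⟩ʳ_) e) (trans (cong (λ t → pow σ t (to x)) eq) (powN (to x))))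
    ... | inj₁ d+2<N with ≤-total (2+ d + 2+ d) N
    ... | inj₁ le = contradiction (subst (Three ∘ Separates (to x)) (sym e)
                      (three-separators {2+ d} (ρ-to ρx) (s≤s (s≤s z≤n)) le)) (at-most-two ρx)
    ... | inj₂ ge = contradiction (three-map separates-sym (subst (Three ∘ Separates (to (σ ⟨$⟩ʳ x))) back
                      (three-separators {N ∸ 2+ d} (ρ-to (ρ-pow0 1 ρx)) (m+n≤o⇒m≤o∸n 2 d+2<N) le))) (at-most-two ρx)
      where
      le : (N ∸ 2+ d) + (N ∸ 2+ d) ≤ N
      le = subst ((N ∸ 2+ d) + (N ∸ 2+ d) ≤_) (m∸n+n≡m (<⇒≤ d<N))
             (+-monoʳ-≤ (N ∸ 2+ d) (m≤n+o⇒m∸n≤o N (2+ d) ge))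
      back : pow σ (N ∸ 2+ d) (to (σ ⟨$⟩ʳ x)) ≡ to x
      back = trans (cong (pow σ (N ∸ 2+ d)) e) (trans (sym (pow-+ σ (N ∸ 2+ d) (2+ d) (to x)))
        (trans (cong (λ t → pow σ t (to x)) (m∸n+n≡m (<⇒≤ d<N))) (powN (to x))))

    private
      σσ≢ : ∀ {x} → ρ x ≡ 0 → x ≢ pow σ 2 x
      σσ≢ ρx = distinct {0} {2} ρx (s≤s z≤n) (≤-<-trans 2≤K K<N)

      -- A change of direction at `σ x` would give `x` and `pow σ 2 x` the same image.
      forward-step : ∀ {x} → ρ x ≡ 0 → Forward x → Forward (σ ⟨$⟩ʳ x)
      forward-step {x} ρx F = [ (λ F′ → F′) , (λ B → contradiction
        (to-injective (sym (perm-injective σ (trans B F)))) (σσ≢ ρx)) ]′ (adjacent (ρ-pow0 1 ρx))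

      backward-step : ∀ {x} → ρ x ≡ 0 → Backward x → Backward (σ ⟨$⟩ʳ x)
      backward-step {x} ρx B = [ (λ F → contradiction
        (to-injective (sym (trans F B))) (σσ≢ ρx)) , (λ B′ → B′) ]′ (adjacent (ρ-pow0 1 ρx))

      spread : ∀ {P : Fin m → Set} → (∀ {x} → ρ x ≡ 0 → P x → P (σ ⟨$⟩ʳ x)) → P (rep 0) → ∀ {x} → ρ x ≡ 0 → P x
      spread {P} st P0 {x} ρx = subst P (trans (cong (λ i → vtx i (c x)) (sym ρx)) (vtx-c x)) (go (c x))
        where
        go : ∀ t → P (vtx 0 t)
        go zero    = P0
        go (suc t) = st (ρ-vtx t z≤n) (go t)

    Dihedral : Set
    Dihedral = (∀ {x} → ρ x ≡ 0 → Forward x) ⊎ (∀ {x} → ρ x ≡ 0 → Backward x)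

    dihedral : Dihedral
    dihedral = [ inj₁ ∘ spread forward-step , inj₂ ∘ spread backward-step ]′ (adjacent (ρ-vtx 0 z≤n))

-- The layered graph

ε : ℕ → Bool
ε zero    = false
ε (suc j) = not (ε j)

ε-dichotomy : ∀ i j → ε i ≡ ε j ⊎ ε i ≡ not (ε j)
ε-dichotomy i j with ε i Bool.≟ ε j
... | yes e = inj₁ e
... | no ¬e = inj₂ (¬-not ¬e)

shade : Bool → Bool → Bool
shade true  b = b
shade false b = not b

module Graph {m} {σ : Permutation′ m} (S : OrbitSystem σ) (K : ℕ) (2≤K : 2 ≤ K) (4K<N : 4 * K < OrbitSystem.N S)
  (D : ℕ) (δ : Fin D → ℕ) where

  open OrbitSystem S
  open Circulant S K 2≤K 4K<N

  -- δ lists the offsets by which a vertex of the main orbit (rank 0) may differ from its exceptional neighbours.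
  Sync : Fin m → Fin m → Set
  Sync u v = ∃ λ i → π (ρ v) u ≡ pow σ (δ i) v

  -- The bound `ρ v ≤ T` leaves fixed points without exceptional pairs, so their layers have
  -- threshold 0. The second alternative is oriented: it distinguishes `σ` from its inverse.
  Exceptional : Fin m → Fin m → Set
  Exceptional u v = (ρ u ≡ 0 × ρ v ≤ T × Sync u v) ⊎ (ρ u ≡ 1 × ρ v ≡ 2 × 2 ≤ T × π 1 v ≡ σ ⟨$⟩ʳ u)

  exceptional? : ∀ u v → Dec (Exceptional u v)
  exceptional? u v =
    (ρ u ≟ 0) ×-dec (ρ v ≤? T) ×-dec any? (λ i → π (ρ v) u Fin.≟ pow σ (δ i) v)
    ⊎-dec (ρ u ≟ 1) ×-dec (ρ v ≟ 2) ×-dec (2 ≤? T) ×-dec (π 1 v Fin.≟ (σ ⟨$⟩ʳ u))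

  across : Fin m → Fin m → Bool
  across u v = shade (does (exceptional? u v)) (ε (ρ v))

  -- With `not (ε j)` inside layer `j`, a vertex has no neighbour of its layer's colour in its own
  -- orbit, but has neighbours of the opposite colour when later layers are compared.
  inside : ℕ → Fin m → Fin m → Bool
  inside zero    u v = does (near? u v)
  inside (suc j) u v = not (ε (suc j))

  E : Fin m → Fin m → Bool
  E u v with <-cmp (ρ u) (ρ v)
  ... | tri< _ _ _ = across u v
  ... | tri≈ _ _ _ = inside (ρ u) u v
  ... | tri> _ _ _ = across v u

  E-< : ∀ {u v} → ρ u < ρ v → E u v ≡ across u v
  E-< {u} {v} u<v with <-cmp (ρ u) (ρ v)
  ... | tri< _ _ _   = refl
  ... | tri≈ u≮v _ _ = contradiction u<v u≮v
  ... | tri> u≮v _ _ = contradiction u<v u≮v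

  E-> : ∀ {u v} → ρ v < ρ u → E u v ≡ across v u
  E-> {u} {v} v<u with <-cmp (ρ u) (ρ v)
  ... | tri< _ _ v≮u = contradiction v<u v≮u
  ... | tri≈ _ _ v≮u = contradiction v<u v≮u
  ... | tri> _ _ _   = refl

  E-≡ : ∀ {u v} → ρ u ≡ ρ v → E u v ≡ inside (ρ u) u v
  E-≡ {u} {v} e with <-cmp (ρ u) (ρ v)
  ... | tri< _ u≢v _ = contradiction e u≢v
  ... | tri≈ _ _ _   = refl
  ... | tri> _ u≢v _ = contradiction e u≢v

  inside-sym : ∀ j u v → inside j u v ≡ inside j v u
  inside-sym zero    u v = does-⇔ (mk⇔ near-sym near-sym) (near? u v) (near? v u)
  inside-sym (suc j) u v = refl

  E-sym : ∀ u v → E u v ≡ E v u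
  E-sym u v with <-cmp (ρ u) (ρ v)
  ... | tri< u<v _ _ = sym (E-> u<v)
  ... | tri≈ _ e _   = trans (inside-sym (ρ u) u v) (sym (trans (E-≡ (sym e)) (cong (λ j → inside j v u) (sym e))))
  ... | tri> _ _ v<u = sym (E-< v<u)

  E-main : ∀ {u v} → ρ u ≡ 0 → ρ v ≡ 0 → E u v ≡ does (near? u v)
  E-main {u} {v} ρu ρv = trans (E-≡ (trans ρu (sym ρv))) (cong (λ j → inside j u v) ρu)

  E-inside : ∀ {u v} → 1 ≤ ρ u → ρ u ≡ ρ v → E u v ≡ not (ε (ρ u))
  E-inside {u} {v} 1≤ρ e = trans (E-≡ e) (inside-positive (ρ u) 1≤ρ)
    where
    inside-positive : ∀ j → 1 ≤ j → inside j u v ≡ not (ε j)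
    inside-positive (suc j) _ = refl

  E-exceptional : ∀ {u v} → ρ u < ρ v → Exceptional u v → E u v ≡ ε (ρ v)
  E-exceptional {u} {v} u<v x = trans (E-< u<v) (cong (λ b → shade b (ε (ρ v))) (dec-true (exceptional? u v) x))

  E-ordinary : ∀ {u v} → ρ u < ρ v → ¬ Exceptional u v → E u v ≡ not (ε (ρ v))
  E-ordinary {u} {v} u<v x = trans (E-< u<v) (cong (λ b → shade b (ε (ρ v))) (dec-false (exceptional? u v) x))

  exceptional : ∀ {u v} → ρ u < ρ v → E u v ≡ ε (ρ v) → Exceptional u v
  exceptional {u} {v} u<v e with exceptional? u v
  ... | yes x = x
  ... | no ¬x = contradiction (trans (sym e) (E-ordinary u<v ¬x)) (not-¬ refl)

  q-top-ρ : ∀ {j u} → ρ u ≡ 0 → j ≤ R → q j ∣ q (ρ u)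
  q-top-ρ {j} ρu j≤R = subst (λ i → q j ∣ q i) (sym ρu) (q-top j≤R)

  π-σ : ∀ {j} u → ρ u ≡ 0 → j ≤ R → π j (σ ⟨$⟩ʳ u) ≡ σ ⟨$⟩ʳ π j u
  π-σ u ρu j≤R = π-pow 1 u j≤R (q-top-ρ ρu j≤R)

  private
    1≤R : 2 ≤ T → 1 ≤ R
    1≤R 2≤T = ≤-trans (s≤s z≤n) (≤-trans 2≤T T≤R)

    π-σ₂ : ∀ {v} → ρ v ≡ 2 → 2 ≤ T → π 1 (σ ⟨$⟩ʳ v) ≡ σ ⟨$⟩ʳ π 1 v
    π-σ₂ {v} ρv 2≤T = π-pow 1 v (1≤R 2≤T) (subst (λ i → q 1 ∣ q i) (sym ρv) (q-chain (s≤s z≤n) (s≤s z≤n) 2≤T))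

    exceptional-σ : ∀ {u v} → Exceptional u v → Exceptional (σ ⟨$⟩ʳ u) (σ ⟨$⟩ʳ v)
    exceptional-σ {u} {v} (inj₁ (ρu , ρv , i , e)) = inj₁ (trans (ρ-σ u) ρu , subst (_≤ T) (sym (ρ-σ v)) ρv ,
      i , (trans (cong (λ j → π j (σ ⟨$⟩ʳ u)) (ρ-σ v)) (trans (π-σ u ρu (ρ≤R v))
            (trans (cong (σ ⟨$⟩ʳ_) e) (pow-sucʳ σ (δ i) v)))))
    exceptional-σ {u} {v} (inj₂ (ρu , ρv , 2≤T , e)) = inj₂ (trans (ρ-σ u) ρu , trans (ρ-σ v) ρv , 2≤T ,
      trans (π-σ₂ ρv 2≤T) (cong (σ ⟨$⟩ʳ_) e))

    exceptional-σ⁻ : ∀ {u v} → Exceptional (σ ⟨$⟩ʳ u) (σ ⟨$⟩ʳ v) → Exceptional u v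
    exceptional-σ⁻ {u} {v} (inj₁ (ρu , ρv , i , e)) = inj₁ (trans (sym (ρ-σ u)) ρu , subst (_≤ T) (ρ-σ v) ρv ,
      i , perm-injective σ (trans (sym (π-σ u (trans (sym (ρ-σ u)) ρu) (ρ≤R v)))
            (trans (cong (λ j → π j (σ ⟨$⟩ʳ u)) (sym (ρ-σ v))) (trans e (sym (pow-sucʳ σ (δ i) v))))))
    exceptional-σ⁻ {u} {v} (inj₂ (ρu , ρv , 2≤T , e)) = inj₂ (trans (sym (ρ-σ u)) ρu , trans (sym (ρ-σ v)) ρv , 2≤T ,
      perm-injective σ (trans (sym (π-σ₂ (trans (sym (ρ-σ v)) ρv) 2≤T)) e))

    near-σ : ∀ {u v} → Near u v → Near (σ ⟨$⟩ʳ u) (σ ⟨$⟩ʳ v)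
    near-σ {u} {v} (d , inj₁ e) = d , inj₁ (trans (sym (pow-sucʳ σ (suc (toℕ d)) u)) (cong (σ ⟨$⟩ʳ_) e))
    near-σ {u} {v} (d , inj₂ e) = d , inj₂ (trans (sym (pow-sucʳ σ (suc (toℕ d)) v)) (cong (σ ⟨$⟩ʳ_) e))

    near-σ⁻ : ∀ {u v} → Near (σ ⟨$⟩ʳ u) (σ ⟨$⟩ʳ v) → Near u v
    near-σ⁻ {u} {v} (d , inj₁ e) = d , inj₁ (perm-injective σ (trans (pow-sucʳ σ (suc (toℕ d)) u) e))
    near-σ⁻ {u} {v} (d , inj₂ e) = d , inj₂ (perm-injective σ (trans (pow-sucʳ σ (suc (toℕ d)) v) e))

    across-σ : ∀ u v → across (σ ⟨$⟩ʳ u) (σ ⟨$⟩ʳ v) ≡ across u v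
    across-σ u v = cong₂ shade (does-⇔ (mk⇔ exceptional-σ⁻ exceptional-σ) (exceptional? _ _) (exceptional? u v))
      (cong ε (ρ-σ v))

    inside-σ : ∀ j u v → inside j (σ ⟨$⟩ʳ u) (σ ⟨$⟩ʳ v) ≡ inside j u v
    inside-σ zero    u v = does-⇔ (mk⇔ near-σ⁻ near-σ) (near? _ _) (near? u v)
    inside-σ (suc j) u v = refl

  E-σ : ∀ u v → E (σ ⟨$⟩ʳ u) (σ ⟨$⟩ʳ v) ≡ E u v
  E-σ u v with <-cmp (ρ u) (ρ v)
  ... | tri< u<v _ _ = trans (E-< (subst₂ _<_ (sym (ρ-σ u)) (sym (ρ-σ v)) u<v)) (across-σ u v)
  ... | tri≈ _ e _   = trans (E-≡ (trans (ρ-σ u) (trans e (sym (ρ-σ v)))))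
                         (trans (cong (λ j → inside j _ _) (ρ-σ u)) (inside-σ (ρ u) u v))
  ... | tri> _ _ v<u = trans (E-> (subst₂ _<_ (sym (ρ-σ v)) (sym (ρ-σ u)) v<u)) (across-σ v u)

  open Peeling E ρ ε R public

  -- Counting neighbours layer by layer

  module Layers (1≤T : 1 ≤ T) (i₀ : Fin D) (δ₀ : δ i₀ ≡ 0)
    (δ≢2 : ∀ i {u} → 1 ≤ ρ u → ρ u ≤ T → pow σ 2 u ≢ pow σ (δ i) u)
    (few : ∀ M → N ≡ M * q 1 → D * M < K + K) (single : 2 ≤ T → D ≡ 1) where

    Fibre : Fin m → Fin m → Set
    Fibre u v = ρ v ≡ 0 × π (ρ u) v ≡ u

    module _ (u : Fin m) (M : ℕ) (N≡ : N ≡ M * q (ρ u)) where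
      private
        x = lift u
        x₀ = ρ-lift u

        d<M : ∀ {d} → d * q (ρ u) < N → d < M
        d<M {d} lt = *-cancelʳ-< (q (ρ u)) d M (subst (d * q (ρ u) <_) N≡ lt)

        -- `pow σ t x` lies over `u` only if `pow σ t` fixes `u`, that is, if `q (ρ u)` divides `t`.
        index : ∀ v → Fibre u v → ∃ λ d → d < M × v ≡ pow σ (d * q (ρ u)) x
        index v (ρv , e) with reach x₀ ρv
        ... | t , t<N , refl with fix⇒∣ t u (trans (cong (pow σ t) (sym (π-lift u refl)))
                                 (trans (sym (π-pow t x (ρ≤R u) (q-top-ρ x₀ (ρ≤R u)))) e))
        ... | divides d refl = d , d<M t<N , refl

      fibre-most : AtMost M (Fibre u)
      fibre-most = (λ v h → fromℕ< (proj₁ (proj₂ (index v h)))) ,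
        λ v v′ h h′ e → trans (proj₂ (proj₂ (index v h))) (trans
          (cong (λ d → pow σ (d * q (ρ u)) x) (fromℕ<-injective _ _ (proj₁ (proj₂ (index v h))) (proj₁ (proj₂ (index v′ h′))) e))
          (sym (proj₂ (proj₂ (index v′ h′)))))

      fibre-least : AtLeast M (Fibre u)
      fibre-least = g , g-inj , λ i → ρ-pow0 (toℕ i * q (ρ u)) x₀ ,
          trans (π-pow (toℕ i * q (ρ u)) x (ρ≤R u) (q-top-ρ x₀ (ρ≤R u)))
            (trans (cong (pow σ (toℕ i * q (ρ u))) (π-lift u refl)) (∣⇒fix _ u (n∣m*n (toℕ i))))
        where
        g : Fin M → Fin m
        g i = pow σ (toℕ i * q (ρ u)) x
        q≢0 : NonZero (q (ρ u))
        q≢0 = >-nonZero (≤-<-trans z≤n (c<q u))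
        small : ∀ i → toℕ i * q (ρ u) < q (ρ x)
        small i = subst (toℕ i * q (ρ u) <_) (trans (sym N≡) (cong q (sym x₀))) (*-monoˡ-< (q (ρ u)) {{q≢0}} (toℕ<n i))
        g-inj : ∀ i j → g i ≡ g j → i ≡ j
        g-inj i j e = toℕ-injective (*-cancelʳ-≡ (toℕ i) (toℕ j) (q (ρ u)) {{q≢0}} (exp-injective x (small i) (small j) e))

    MainNb : Bool → Fin m → Fin m → Set
    MainNb b u v = ρ v ≡ 0 × u ≢ v × E u v ≡ b

    -- Here `4K < N` pays for both colours: the `2K` vertices at distance at most `K` have one
    -- colour, and the exponents K + 1, ..., 3K all lead to vertices at greater distance.
    main-least : ∀ b u → ρ u ≡ 0 → AtLeast (K + K) (MainNb b u)
    main-least true u ρu = g , g-inj , props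
      where
      -- The exponents 1, ..., K, followed by N - K, ..., N - 1 for `d` from K to 2K - 1.
      e : ℕ → ℕ
      e d with d <? K
      ... | yes _ = suc d
      ... | no _  = (N ∸ (K + K)) + d
      low : ∀ {d} → d < K + K → N ∸ (K + K) + d < N
      low {d} d< = subst (N ∸ (K + K) + d <_) (m∸n+n≡m (<⇒≤ 2K<N)) (+-monoʳ-< (N ∸ (K + K)) d<)
      e-bounds : ∀ d → d < K + K → 0 < e d × e d < N × Near u (pow σ (e d) u)
      e-bounds d d< with d <? K
      ... | yes d<K = s≤s z≤n , ≤-<-trans d<K K<N , near-low (s≤s z≤n) d<K
      ... | no d≮K  = ≤-trans (≤-trans (s≤s z≤n) 2≤K) (≤-trans (≮⇒≥ d≮K) (m≤n+m d (N ∸ (K + K)))) , low d< ,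
                      near-high (low d<) (subst (_≤ K + (N ∸ (K + K) + d)) eq
                        (+-monoʳ-≤ K (+-monoʳ-≤ (N ∸ (K + K)) (≮⇒≥ d≮K))))
        where
        eq : K + (N ∸ (K + K) + K) ≡ N
        eq = trans (+-comm K _) (trans (+-assoc _ K K) (m∸n+n≡m (<⇒≤ 2K<N)))
      gap : ∀ {a b} → a < K → ¬ b < K → suc a ≢ N ∸ (K + K) + b
      gap a<K b≮K eq = <⇒≢ (≤-<-trans a<K (≤-<-trans (≮⇒≥ b≮K) (m<n+m _ (m<n⇒0<n∸m 2K<N)))) eq
      e-inj : ∀ a b → e a ≡ e b → a ≡ b
      e-inj a b eq with a <? K | b <? K
      ... | yes _ | yes _ = suc-injective eq
      ... | no _  | no _  = +-cancelˡ-≡ _ a b eq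
      ... | yes a<K | no b≮K = contradiction eq (gap a<K b≮K)
      ... | no a≮K | yes b<K = contradiction (sym eq) (gap b<K a≮K)
      g : Fin (K + K) → Fin m
      g i = pow σ (e (toℕ i)) u
      lt : ∀ i → e (toℕ i) < q (ρ u)
      lt i = subst (e (toℕ i) <_) (cong q (sym ρu)) (proj₁ (proj₂ (e-bounds (toℕ i) (toℕ<n i))))
      g-inj : ∀ i j → g i ≡ g j → i ≡ j
      g-inj i j eq = toℕ-injective (e-inj _ _ (exp-injective u (lt i) (lt j) eq))
      props : ∀ i → MainNb true u (g i)
      props i with e-bounds (toℕ i) (toℕ<n i)
      ... | 0<e , e<N , nr = ρ-pow0 (e (toℕ i)) ρu , distinct {0} ρu 0<e e<N ,
                             trans (E-main ρu (ρ-pow0 (e (toℕ i)) ρu)) (dec-true (near? _ _) nr)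
    main-least false u ρu = g , g-inj , props
      where
      e : Fin (K + K) → ℕ
      e i = K + suc (toℕ i)
      K+e<N : ∀ i → K + e i < N
      K+e<N i = ≤-<-trans (subst (K + e i ≤_) (sym (+-assoc K K (K + K))) (+-monoʳ-≤ K (+-monoʳ-≤ K (toℕ<n i)))) 2K+2K<N
      e<N : ∀ i → e i < N
      e<N i = ≤-<-trans (m≤n+m (e i) K) (K+e<N i)
      g : Fin (K + K) → Fin m
      g i = pow σ (e i) u
      g-inj : ∀ i j → g i ≡ g j → i ≡ j
      g-inj i j eq = toℕ-injective (suc-injective (+-cancelˡ-≡ K _ _ (exp-injective u
        (subst (e i <_) (cong q (sym ρu)) (e<N i)) (subst (e j <_) (cong q (sym ρu)) (e<N j)) eq)))
      props : ∀ i → MainNb false u (g i)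
      props i = ρ-pow0 (e i) ρu , distinct {0} ρu (≤-trans (≤-trans (s≤s z≤n) 2≤K) (m≤m+n K _)) (e<N i) ,
                trans (E-main ρu (ρ-pow0 (e i) ρu)) (dec-false (near? _ _) (not-near ρu (m<m+n K (s≤s z≤n)) (K+e<N i)))

    private
      T≤⇒R : ∀ {j} → j ≤ T → j ≤ R
      T≤⇒R j≤T = ≤-trans j≤T T≤R

    blocks : ∀ {j} → j ≤ R → ∃ λ M → N ≡ M * q j
    blocks j≤R with q-top j≤R
    ... | divides M e = M , e

    blocks-antitone : ∀ {i j M M′} → 1 ≤ i → i ≤ j → j ≤ T → N ≡ M * q i → N ≡ M′ * q j → M′ ≤ M
    blocks-antitone {i} {j} {M} {M′} 1≤i i≤j j≤T e e′ = *-cancelʳ-≤ M′ M (q i) {{>-nonZero (≤-trans (s≤s z≤n) (3≤q (≤-trans i≤j j≤T)))}}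
      (subst (M′ * q i ≤_) (trans (sym e′) e) (*-monoʳ-≤ M′ (∣⇒≤ {{>-nonZero (≤-trans (s≤s z≤n) (3≤q j≤T))}} (q-chain 1≤i i≤j j≤T))))

    upper : ∀ {j u v} → 1 ≤ j → ρ u ≡ j → Nb j u v → ρ v < ρ u × Exceptional v u
    upper {u = u} {v} 1≤j refl (u≢v , v≤j , e) with m≤n⇒m<n∨m≡n v≤j
    ... | inj₁ v<u = v<u , exceptional v<u (trans (E-sym v u) e)
    ... | inj₂ eq = contradiction (trans (sym e) (E-inside 1≤j (sym eq))) (not-¬ refl)

    E-fibre : ∀ {u v} → 1 ≤ ρ u → ρ u ≤ T → Fibre u v → E u v ≡ ε (ρ u)
    E-fibre {u} {v} 1≤ ≤T (ρv , e) = trans (E-sym u v) (E-exceptional (subst (_< ρ u) (sym ρv) 1≤)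
      (inj₁ (ρv , ≤T , i₀ , trans e (cong (λ t → pow σ t u) (sym δ₀)))))

    -- No offset is congruent to 2, so everything over `pow σ 2 u` is ordinary for `u`. This
    -- supplies a whole fibre of neighbours of the colour opposite to `ε (ρ u)`.
    E-off-fibre : ∀ {u v} → 1 ≤ ρ u → ρ u ≤ T → ρ v ≡ 0 → π (ρ u) v ≡ pow σ 2 u → E u v ≡ not (ε (ρ u))
    E-off-fibre {u} {v} 1≤ ≤T ρv e = trans (E-sym u v) (E-ordinary (subst (_< ρ u) (sym ρv) 1≤)
      λ { (inj₁ (_ , _ , i , e′)) → δ≢2 i 1≤ ≤T (trans (sym e) e′)
        ; (inj₂ (ρv′ , _)) → contradiction (trans (sym ρv) ρv′) λ () })

    Most Least : ℕ → ℕ → Set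
    Most  j w = ∀ u → ρ u ≡ j → AtMost w (Nb j u)
    Least j w = ∀ u → ρ u < j → AtLeast w (Nb j u)

    most-fibres : ∀ {j M} → 1 ≤ j → N ≡ M * q j → ∀ u → ρ u ≡ j →
      AtMost (D * M) (λ v → ∃ λ i → Fibre (pow σ (δ i) u) v)
    most-fibres {j} {M} 1≤j N≡ u refl = atMost-⋃ λ i → fibre-most (pow σ (δ i) u) M
      (subst (λ k → N ≡ M * q k) (sym (ρ-pow (δ i) u)) N≡)

    to-fibre : ∀ {u v} → ρ v ≡ 0 → Sync v u → ∃ λ i → Fibre (pow σ (δ i) u) v
    to-fibre {u} {v} ρv (i , e) = i , ρv , trans (cong (λ k → π k v) (ρ-pow (δ i) u)) e

    most-sync : ∀ {j M} → 1 ≤ j → j ≢ 2 → N ≡ M * q j → Most j (D * M)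
    most-sync {j} {M} 1≤j j≢2 N≡ u ρu = atMost-map {P = Nb j u} {Q = λ v → ∃ λ i → Fibre (pow σ (δ i) u) v}
      (λ nb → conv (proj₂ (upper 1≤j ρu nb))) (most-fibres 1≤j N≡ u ρu)
      where
      conv : ∀ {v} → Exceptional v u → ∃ λ i → Fibre (pow σ (δ i) u) v
      conv (inj₁ (ρv , _ , s)) = to-fibre ρv s
      conv (inj₂ (_ , ρu≡2 , _)) = contradiction (trans (sym ρu) ρu≡2) j≢2

    -- The shifted relation with the first orbit contributes at most one vertex, whence the `suc`.
    most-two : ∀ {M} → N ≡ M * q 2 → Most 2 (suc (D * M))
    most-two {M} N≡ u ρu = atMost-map {P = Nb 2 u} {Q = λ v → (∃ λ i → Fibre (pow σ (δ i) u) v) ⊎ π 1 u ≡ σ ⟨$⟩ʳ v}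
      (λ nb → conv (proj₂ (upper (s≤s z≤n) ρu nb)))
      (atMost-suc (most-fibres (s≤s z≤n) N≡ u ρu) λ v v′ e e′ → perm-injective σ (trans (sym e) e′))
      where
      conv : ∀ {v} → Exceptional v u → _
      conv (inj₁ (ρv , _ , s)) = inj₁ (to-fibre ρv s)
      conv (inj₂ (_ , _ , _ , e)) = inj₂ e

    most-fixed : ∀ {j} → T < j → Most j 0
    most-fixed {j} T<j u ρu = atMost-map {P = Nb j u} {Q = λ _ → Fin 0}
      (λ nb → contradiction (conv (proj₂ (upper (≤-trans (s≤s z≤n) T<j) ρu nb))) (<⇒≱ (subst (T <_) (sym ρu) T<j)))
      ((λ _ ()) , λ _ _ ())
      where
      conv : ∀ {v} → Exceptional v u → ρ u ≤ T
      conv (inj₁ (_ , ≤T , _)) = ≤T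
      conv (inj₂ (_ , ρu≡2 , 2≤T , _)) = subst (_≤ T) (sym ρu≡2) 2≤T

    main-nb : ∀ {j u v} → MainNb (ε j) u v → Nb j u v
    main-nb (ρv , u≢v , e) = u≢v , subst (_≤ _) (sym ρv) z≤n , e

    least-main : ∀ {j w} → w ≤ K + K → ∀ u → ρ u ≡ 0 → AtLeast w (Nb j u)
    least-main {j} w≤ u ρu = atLeast-≤ {P = Nb j u} w≤
      (atLeast-map {P = MainNb (ε j) u} {Q = Nb j u} (λ v → v) (λ e → e) main-nb (main-least (ε j) u ρu))

    -- Since the threshold of layer 2 is raised by one, the bound `K + K` is raised as well, by a
    -- neighbour in the first orbit: its ordinary colour `not (ε 1)` is `ε 2`.
    extra-main : 2 ≤ T → ∀ u → ρ u ≡ 0 → AtLeast (suc (K + K)) (Nb 2 u)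
    extra-main 2≤T u ρu = atLeast-suc {P = MainNb (ε 2) u} {Q = Nb 2 u} main-nb (main-least (ε 2) u ρu) v
        ((λ e → contradiction (trans (sym ρv) (trans (cong ρ (sym e)) ρu)) λ ()) , subst (_≤ 2) (sym ρv) (s≤s z≤n) ,
         trans (E-sym u v) (trans (E-off-fibre (subst (1 ≤_) (sym ρv) ≤-refl) (subst (_≤ T) (sym ρv) 1≤T) ρu
           (trans (cong (λ k → π k u) ρv) (sym σ²v))) (cong (not ∘ ε) ρv)))
        λ (ρv≡0 , _) → contradiction (trans (sym ρv) ρv≡0) λ ()
      where
      -- The translate by -2, so that `u` lies over `pow σ 2 v`, an offset that is never
      -- exceptional.
      v = pow σ (N ∸ 2) (π 1 u)
      ρv : ρ v ≡ 1
      ρv = trans (ρ-pow (N ∸ 2) _) (ρ-π u (T≤⇒R 1≤T))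
      σ²v : pow σ 2 v ≡ π 1 u
      σ²v = trans (sym (pow-+ σ 2 (N ∸ 2) _)) (trans (cong (λ t → pow σ t (π 1 u))
        (m+[n∸m]≡n (≤-trans (n≤1+n 2) (3≤q {0} z≤n)))) (powN (π 1 u)))

    σ≢ : ∀ d {u} → 1 ≤ d → d ≤ 2 → ρ u ≤ T → u ≢ pow σ d u
    σ≢ d {u} 1≤d d≤2 ≤T e = free d u 1≤d (≤-trans (s≤s d≤2) (3≤q ≤T)) (sym e)

    inner-nb : ∀ {j u} d → 1 ≤ d → d ≤ 2 → 1 ≤ ρ u → ρ u ≤ T → ρ u < j → ε j ≡ not (ε (ρ u)) → Nb j u (pow σ d u)
    inner-nb {j} {u} d 1≤d d≤2 1≤ ≤T u<j e = σ≢ d 1≤d d≤2 ≤T , subst (_≤ j) (sym (ρ-pow d u)) (<⇒≤ u<j) ,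
      trans (E-inside 1≤ (sym (ρ-pow d u))) (sym e)

    -- To the fibre over `pow σ 2 u` come `pow σ 1 u` and `pow σ 2 u` from the orbit of `u` itself.
    -- The second of them matters for layer 1 against layer 2, where the threshold is raised by one.
    least-opposite : ∀ {j M} u → 1 ≤ ρ u → ρ u ≤ T → ρ u < j → ε j ≡ not (ε (ρ u)) → N ≡ M * q (ρ u) →
      AtLeast (2 + M) (Nb j u)
    -- The intermediate set leaves out `pow σ 2 u`, which can then be added last as a new element.
    least-opposite {j} {M} u 1≤ ≤T u<j e N≡ = atLeast-suc {P = λ v → Q v × v ≢ pow σ 2 u} {Q = Nb j u} proj₁
      (atLeast-suc {P = Fibre (pow σ 2 u)} {Q = λ v → Q v × v ≢ pow σ 2 u} from-fibre
        (fibre-least (pow σ 2 u) M (subst (λ k → N ≡ M * q k) (sym (ρ-pow 2 u)) N≡))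
        (pow σ 1 u) (inner-nb 1 ≤-refl (s≤s z≤n) 1≤ ≤T u<j e , (λ eq → σ≢ 1 ≤-refl (s≤s z≤n) ≤T (perm-injective σ eq)))
        (not-main 1 ∘ proj₁))
      (pow σ 2 u) (inner-nb 2 (s≤s z≤n) ≤-refl 1≤ ≤T u<j e) λ (_ , n) → n refl
      where
      Q = Nb j u
      not-main : ∀ d → ρ (pow σ d u) ≢ 0
      not-main d ρ0 = contradiction (subst (1 ≤_) (trans (sym (ρ-pow d u)) ρ0) 1≤) λ ()
      from-fibre : ∀ {v} → Fibre (pow σ 2 u) v → Q v × v ≢ pow σ 2 u
      from-fibre {v} (ρv , eq) = ((λ u≡v → not-main 0 (trans (cong ρ u≡v) ρv)) , subst (_≤ j) (sym ρv) z≤n ,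
        trans (E-off-fibre 1≤ ≤T ρv (trans (cong (λ k → π k v) (sym (ρ-pow 2 u))) eq)) (sym e)) ,
        λ v≡ → not-main 2 (trans (cong ρ (sym v≡)) ρv)

    -- An ordinary pair with the next layer has the colour `not (ε (suc (ρ u)))`, which by
    -- alternation is `ε (ρ u)`.
    next : ∀ {u} → ρ u < R → ∃ λ v → ρ v ≡ suc (ρ u) × (1 ≤ ρ u → E u v ≡ ε (ρ u))
    next {u} u<R = v , ρv , λ 1≤ → trans (E-ordinary (subst (ρ u <_) (sym ρv) ≤-refl) (ordinary 1≤))
                                     (trans (cong (not ∘ ε) ρv) (not-involutive (ε (ρ u))))
      where
      -- With the same exponent as `u` the vertex projects to `u`, not to `σ u`, and so avoids the
      -- shifted relation between layers 1 and 2.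
      v = vtx (suc (ρ u)) (c u)
      ρv : ρ v ≡ suc (ρ u)
      ρv = ρ-vtx (c u) u<R
      ordinary : 1 ≤ ρ u → ¬ Exceptional u v
      ordinary 1≤ (inj₁ (ρu , _)) = contradiction (subst (1 ≤_) ρu 1≤) λ ()
      ordinary 1≤ (inj₂ (ρu , _ , 2≤T , e)) = σ≢ 1 ≤-refl (s≤s z≤n) (subst (_≤ T) (sym ρu) 1≤T) (trans (sym π₁v) e)
        where
        π₁v : π 1 v ≡ u
        π₁v = trans (π-vtx (c u) u<R (T≤⇒R 1≤T) (q-chain ≤-refl (s≤s z≤n) (subst (λ k → suc k ≤ T) (sym ρu) 2≤T)))
          (trans (cong (λ k → vtx k (c u)) (sym ρu)) (vtx-c u))

    next-nb : ∀ {j u} → 1 ≤ ρ u → ρ u < j → j ≤ R → ε j ≡ ε (ρ u) → ∃ λ v → ρ v ≡ suc (ρ u) × Nb j u v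
    next-nb {j} {u} 1≤ u<j j≤R e with next {u} (<-≤-trans u<j j≤R)
    ... | v , ρv , col = v , ρv , (λ { refl → <⇒≢ (n<1+n (ρ u)) ρv }) , subst (_≤ j) (sym ρv) u<j , trans (col 1≤) (sym e)

    -- The fibre alone may tie, namely for orbits of equal size; the vertex from the next layer
    -- breaks the tie.
    least-same : ∀ {j M} u → 1 ≤ ρ u → ρ u ≤ T → ρ u < j → j ≤ R → ε j ≡ ε (ρ u) → N ≡ M * q (ρ u) →
      AtLeast (1 + M) (Nb j u)
    least-same {j} {M} u 1≤ ≤T u<j j≤R e N≡ with next-nb {j} {u} 1≤ u<j j≤R e
    ... | v , ρv , nb = atLeast-suc {P = Fibre u} {Q = Nb j u} from-fibre (fibre-least u M N≡) v nb
          λ (ρv≡0 , _) → contradiction (trans (sym ρv) ρv≡0) λ ()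
      where
      from-fibre : ∀ {v} → Fibre u v → Nb j u v
      from-fibre {v} (ρv , eq) = (λ { refl → contradiction (subst (1 ≤_) ρv 1≤) λ () }) ,
        subst (_≤ j) (sym ρv) z≤n , trans (E-fibre 1≤ ≤T (ρv , eq)) (sym e)

    least-mid : ∀ {j M} u → 1 ≤ ρ u → ρ u ≤ T → ρ u < j → j ≤ R → N ≡ M * q (ρ u) → AtLeast (1 + M) (Nb j u)
    least-mid {j} u 1≤ ≤T u<j j≤R N≡ with ε-dichotomy j (ρ u)
    ... | inj₁ e = least-same u 1≤ ≤T u<j j≤R e N≡
    ... | inj₂ e = atLeast-≤ {P = Nb j u} (n≤1+n _) (least-opposite u 1≤ ≤T u<j e N≡)

    -- One neighbour exceeds the threshold 0: the next fixed point if the colours agree, a vertex of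
    -- the main orbit otherwise.
    least-fixed : ∀ {j} u → T < ρ u → ρ u < j → j ≤ R → AtLeast 1 (Nb j u)
    least-fixed {j} u T<u u<j j≤R with ε-dichotomy j (ρ u)
    ... | inj₁ e with next-nb {j} {u} (≤-trans (s≤s z≤n) T<u) u<j j≤R e
    ... | v , _ , nb = atLeast-1 {P = Nb j u} v nb
    least-fixed {j} u T<u u<j j≤R | inj₂ e = atLeast-1 {P = Nb j u} (rep 0)
      ((λ u≡ → <⇒≱ T<u (subst (_≤ T) (sym (trans (cong ρ u≡) ρ0)) z≤n)) , subst (_≤ j) (sym ρ0) z≤n ,
       trans (E-sym u (rep 0)) (trans (E-ordinary (subst (_< ρ u) (sym ρ0) (≤-trans (s≤s z≤n) T<u))
         λ { (inj₁ (_ , ≤T , _)) → <⇒≱ T<u ≤T ; (inj₂ (ρ1 , _)) → contradiction (trans (sym ρ0) ρ1) λ () }) (sym e)))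
      where
      ρ0 : ρ (rep 0) ≡ 0
      ρ0 = ρ-vtx 0 z≤n

    -- The threshold counts exceptional neighbours: none for a fixed point, otherwise one fibre for
    -- each offset, and one vertex more in layer 2. As sizes grow with the rank, the fibres of
    -- earlier layers are at least as large.
    peel : ∀ j → 1 ≤ j → j ≤ R → Peelable j
    peel j 1≤j j≤R with j ≤? T
    ... | no j≰T = 0 , most-fixed (≰⇒> j≰T) , least
      where
      least : Least j 1
      least u u<j with m≤n⇒m<n∨m≡n (z≤n {ρ u}) | ρ u ≤? T
      ... | inj₂ 0≡ | _ = least-main (≤-trans (≤-trans (s≤s z≤n) 2≤K) (m≤m+n K K)) u (sym 0≡)
      ... | inj₁ 1≤ | no u≰T = least-fixed u (≰⇒> u≰T) u<j j≤R
      ... | inj₁ 1≤ | yes u≤T = atLeast-≤ {P = Nb j u} (s≤s z≤n)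
              (least-mid {M = proj₁ (blocks (ρ≤R u))} u 1≤ u≤T u<j j≤R (proj₂ (blocks (ρ≤R u))))
    ... | yes j≤T with j ≟ 1 | j ≟ 2
    ... | yes refl | _ = D * M , most-sync 1≤j (λ ()) N≡ , λ u u<1 → least-main (few M N≡) u (n<1⇒n≡0 u<1)
      where
      M = proj₁ (blocks j≤R)
      N≡ = proj₂ (blocks j≤R)
    ... | no _ | yes refl = suc (D * M) , most-two N≡ , least
      where
      M = proj₁ (blocks j≤R)
      N≡ = proj₂ (blocks j≤R)
      D≡1 = single j≤T
      M₁ = proj₁ (blocks (T≤⇒R 1≤T))
      N≡₁ = proj₂ (blocks (T≤⇒R 1≤T))
      M≤M₁ : M ≤ M₁
      M≤M₁ = blocks-antitone {M = M₁} {M} ≤-refl 1≤j j≤T N≡₁ N≡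
      least : Least 2 (suc (suc (D * M)))
      least u u<2 with m≤n⇒m<n∨m≡n (z≤n {ρ u})
      ... | inj₂ 0≡ = atLeast-≤ {P = Nb 2 u} (s≤s (≤-<-trans (*-monoʳ-≤ D M≤M₁) (few _ N≡₁))) (extra-main j≤T u (sym 0≡))
      ... | inj₁ 1≤ = atLeast-≤ {P = Nb 2 u} (s≤s (s≤s (subst (_≤ M₁) (sym (trans (cong (_* M) D≡1) (*-identityˡ M))) M≤M₁)))
              (least-opposite u 1≤ (subst (_≤ T) (sym u≡1) 1≤T) u<2
                (sym (cong (not ∘ ε) u≡1)) (trans N≡₁ (cong (λ k → M₁ * q k) (sym u≡1))))
        where
        u≡1 : ρ u ≡ 1
        u≡1 = ≤-antisym (≤-pred u<2) 1≤
    peel j 1≤j j≤R | yes j≤T | no j≢1 | no j≢2 = D * M , most-sync 1≤j j≢2 N≡ , least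
      where
      M = proj₁ (blocks j≤R)
      N≡ = proj₂ (blocks j≤R)
      D≡1 = single (≤-trans (≤∧≢⇒< 1≤j (j≢1 ∘ sym)) j≤T)
      DM≡M : D * M ≡ M
      DM≡M = trans (cong (_* M) D≡1) (*-identityˡ M)
      least : Least j (suc (D * M))
      least u u<j with m≤n⇒m<n∨m≡n (z≤n {ρ u})
      ... | inj₂ 0≡ = least-main (≤-<-trans (*-monoʳ-≤ D (blocks-antitone {M = M₁} {M} ≤-refl 1≤j j≤T N≡₁ N≡)) (few M₁ N≡₁)) u (sym 0≡)
        where
        M₁ = proj₁ (blocks (T≤⇒R 1≤T))
        N≡₁ = proj₂ (blocks (T≤⇒R 1≤T))
      ... | inj₁ 1≤ = atLeast-≤ {P = Nb j u} (s≤s (subst (_≤ proj₁ (blocks (ρ≤R u))) (sym DM≡M)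
              (blocks-antitone {M = proj₁ (blocks (ρ≤R u))} {M} 1≤ (<⇒≤ u<j) j≤T (proj₂ (blocks (ρ≤R u))) N≡)))
              (least-mid {M = proj₁ (blocks (ρ≤R u))} u 1≤ (≤-trans (<⇒≤ u<j) j≤T) u<j j≤R (proj₂ (blocks (ρ≤R u))))

    rank-preserved : (A : Automorphism E) → ∀ u → ρ (Automorphism.to A u) ≡ ρ u
    rank-preserved = preserves-rank peel ρ≤R

-- Membership

module _ {m} {σ : Permutation′ m} where

  invariant-pow : ∀ {k} {col : Fin m → Fin m → Fin k} →
    (∀ u v → col (σ ⟨$⟩ʳ u) (σ ⟨$⟩ʳ v) ≡ col u v) → ∀ t u v → col (pow σ t u) (pow σ t v) ≡ col u v
  invariant-pow inv zero    u v = refl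
  invariant-pow inv (suc t) u v = trans (inv _ _) (invariant-pow inv t u v)

  rigid⇒InGR : ∀ {k} (G : ColoredGraph k m) → (∀ u v → ColoredGraph.col G (σ ⟨$⟩ʳ u) (σ ⟨$⟩ʳ v) ≡ ColoredGraph.col G u v) →
    (∀ τ → IsAut G τ → InCyclic σ τ) → InGR k σ
  rigid⇒InGR G inv rigid = G , λ τ → mk⇔ (rigid τ) λ (t , e) u v _ →
    trans (cong₂ (ColoredGraph.col G) (e u) (e v)) (invariant-pow {col = ColoredGraph.col G} inv t u v)

automorphism : ∀ {m k} (G : ColoredGraph k m) {E : Fin m → Fin m → Bool} (decode : Fin k → Bool) →
  (∀ u v → decode (ColoredGraph.col G u v) ≡ E u v) → ∀ τ → IsAut G τ → Automorphism E
automorphism G decode dec τ aut = record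
  { to = τ ⟨$⟩ʳ_ ; from = τ ⟨$⟩ˡ_ ; to-from = λ _ → inverseʳ τ ; from-to = λ _ → inverseˡ τ
  ; to-pres = λ u v u≢v → trans (sym (dec _ _)) (trans (cong decode (aut u v u≢v)) (dec u v)) }

fromBool : Bool → Fin 2
fromBool true  = suc zero
fromBool false = zero

-- A third colour reads as `false`, which is the colour in `E` of the pairs that will receive it.
toBool : ∀ {k} → Fin k → Bool
toBool (suc zero) = true
toBool _          = false

toBool-fromBool : ∀ b → toBool (fromBool b) ≡ b
toBool-fromBool true  = refl
toBool-fromBool false = refl

module Rotations {m} {σ : Permutation′ m} (S : OrbitSystem σ) (K : ℕ) (2≤K : 2 ≤ K)
  (4K<N : 4 * K < OrbitSystem.N S) (N≤4K+3 : OrbitSystem.N S ≤ 4 * K + 3) (1≤T : 1 ≤ OrbitSystem.T S) where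

  open OrbitSystem S

  1≤R : 1 ≤ R
  1≤R = ≤-trans 1≤T T≤R

  module WithOffsets (D : ℕ) (δ : Fin D → ℕ) (i₀ : Fin D) (δ₀ : δ i₀ ≡ 0)
    (δ≢2 : ∀ i {u} → 1 ≤ ρ u → ρ u ≤ T → pow σ 2 u ≢ pow σ (δ i) u)
    (few : ∀ M → N ≡ M * q 1 → D * M < K + K) (single : 2 ≤ T → D ≡ 1) where

    open Graph S K 2≤K 4K<N D δ public
    open Layers 1≤T i₀ δ₀ δ≢2 few single public
    open Circulant S K 2≤K 4K<N using (module Rigidity)

    two-coloured : ColoredGraph 2 m
    two-coloured = record { col = λ u v → fromBool (E u v) ; sym = λ u v → cong fromBool (E-sym u v) }

    module _ (A : Automorphism E) where
      open Automorphism A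
      open Rigidity E E-main A (rank-preserved A) public

      -- Ranks are preserved, and across to the main orbit the colour `ε j` marks exactly the
      -- synchronised pairs. With several offsets, that of the image may be another one.
      sync-preserved : ∀ {j u v} → 1 ≤ j → j ≤ T → ρ u ≡ j → ρ v ≡ 0 → (∃ λ i → π j v ≡ pow σ (δ i) u) →
        ∃ λ i → π j (to v) ≡ pow σ (δ i) (to u)
      sync-preserved {u = u} {v} 1≤j j≤T refl ρv s = conclude (exceptional
          (subst₂ _<_ (sym (rank-preserved A v)) (sym (rank-preserved A u)) v<u)
          (trans (to-pres v u λ v≡u → <⇒≢ v<u (cong ρ v≡u))
            (trans (E-exceptional v<u (inj₁ (ρv , j≤T , s))) (cong ε (sym (rank-preserved A u))))))
        where
        v<u : ρ v < ρ u
        v<u = subst (_< ρ u) (sym ρv) 1≤j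
        conclude : Exceptional (to v) (to u) → _
        conclude (inj₁ (_ , _ , i , e)) = i , trans (cong (λ j → π j (to v)) (sym (rank-preserved A u))) e
        conclude (inj₂ (ρv≡1 , _)) = contradiction (trans (sym ρv) (trans (sym (rank-preserved A v)) ρv≡1)) λ ()

      Synchronised : Set
      Synchronised = ∀ {j v} → 1 ≤ j → j ≤ T → ρ v ≡ 0 → to (π j v) ≡ π j (to v)

      synchronised : (∀ i → δ i ≡ 0) → Synchronised
      synchronised δ≡0 {j} {v} 1≤j j≤T ρv
        with sync-preserved {u = π j v} 1≤j j≤T (ρ-π v (≤-trans j≤T T≤R)) ρv (i₀ , cong (λ t → pow σ t (π j v)) (sym δ₀))
      ... | i , e = sym (trans e (cong (λ t → pow σ t (to (π j v))) (δ≡0 i)))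

      -- The image of one base vertex determines the exponent on the main orbit, lifting transfers
      -- it to the other nontrivial orbits, and a fixed point is alone in its rank.
      rotation : (∀ {x} → ρ x ≡ 0 → Forward x) → Synchronised → ∃ λ s → ∀ u → to u ≡ pow σ s u
      rotation F sync = s , go
        where
        s = c (to (rep 0))
        ρ0 : ρ (to (rep 0)) ≡ 0
        ρ0 = ρ-to (ρ-vtx 0 z≤n)
        base : ∀ t → to (vtx 0 t) ≡ pow σ t (to (rep 0))
        base zero    = refl
        base (suc t) = trans (F (ρ-vtx t z≤n)) (cong (σ ⟨$⟩ʳ_) (base t))
        main : ∀ t → to (vtx 0 t) ≡ pow σ s (vtx 0 t)
        main t = trans (base t) (trans (cong (pow σ t) (trans (sym (vtx-c (to (rep 0)))) (cong (λ i → vtx i s) ρ0)))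
          (pow-comm σ t s (rep 0)))
        go : ∀ u → to u ≡ pow σ s u
        go u with m≤n⇒m<n∨m≡n (z≤n {ρ u}) | ρ u ≤? T
        ... | inj₂ 0≡ | _ = subst (λ w → to w ≡ pow σ s w) (trans (cong (λ i → vtx i (c u)) 0≡) (vtx-c u)) (main (c u))
        ... | inj₁ 1≤ | no u≰T = trans (sym (fixed-unique (≰⇒> u≰T) (sym (rank-preserved A u))))
              (sym (trans (cong (λ t → pow σ t u) (sym (*-identityʳ s))) (pow-*-fix σ s {1} (fixed u (≰⇒> u≰T)))))
        ... | inj₁ 1≤ | yes u≤T = begin
                to u                        ≡⟨ cong to (sym (π-lift u refl)) ⟩
                to (π (ρ u) (lift u))       ≡⟨ sync 1≤ u≤T (ρ-lift u) ⟩
                π (ρ u) (to (lift u))       ≡⟨ cong (π (ρ u)) (main (c u)) ⟩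
                π (ρ u) (pow σ s (lift u))  ≡⟨ π-pow s (lift u) (ρ≤R u) (q-top-ρ (ρ-lift u) (ρ≤R u)) ⟩
                pow σ s (π (ρ u) (lift u))  ≡⟨ cong (pow σ s) (π-lift u refl) ⟩
                pow σ s u                   ∎
          where open ≡-Reasoning

      -- A reversal turns `π 1 (to x)` into `σ` of `π 1 (to (σ x))`; together with the excluded
      -- equation, `pow σ 2` would fix a vertex of an orbit with at least three points.
      no-forward-shift : ∀ {x} → ρ x ≡ 0 → Backward x →
        π 1 (to (σ ⟨$⟩ʳ x)) ≢ σ ⟨$⟩ʳ (π 1 (to x))
      no-forward-shift {x} ρx B e = σ≢ 2 (s≤s z≤n) ≤-refl (subst (_≤ T) (sym (ρ-π _ 1≤R)) 1≤T)
        (trans (cong (π 1) (sym B)) (trans (π-σ (to (σ ⟨$⟩ʳ x)) (ρ-to (trans (ρ-σ x) ρx)) 1≤R) (cong (σ ⟨$⟩ʳ_) e)))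

  -- Otherwise `6K ≤ 3w ≤ N ≤ 4K + 3`, so that `2K ≤ 3`, contrary to `2 ≤ K`.
  few₁ : ∀ {w} → 3 * w ≤ N → w < K + K
  few₁ {w} 3w≤N = ≰⇒> λ 2K≤w → <⇒≱ (≤-refl {4}) (+-cancelˡ-≤ (4 * K) 4 3 (begin
    4 * K + 4         ≤⟨ +-monoʳ-≤ (4 * K) (*-monoʳ-≤ 2 2≤K) ⟩
    4 * K + 2 * K     ≡⟨ sym (*-distribʳ-+ K 4 2) ⟩
    6 * K             ≡⟨ *-assoc 3 2 K ⟩
    3 * (2 * K)       ≡⟨ cong (λ y → 3 * (K + y)) (+-identityʳ K) ⟩
    3 * (K + K)       ≤⟨ *-monoʳ-≤ 3 2K≤w ⟩
    3 * w             ≤⟨ 3w≤N ⟩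
    N                 ≤⟨ N≤4K+3 ⟩
    4 * K + 3         ∎))
    where open ≤-Reasoning

  private
    few-one : ∀ M → N ≡ M * q 1 → 1 * M < K + K
    few-one M e = few₁ (subst₂ _≤_ (trans (*-comm M 3) (cong (3 *_) (sym (*-identityˡ M)))) (sym e) (*-monoʳ-≤ M (3≤q 1≤T)))

    avoids-2-zero : ∀ (i : Fin 1) {u} → 1 ≤ ρ u → ρ u ≤ T → pow σ 2 u ≢ u
    avoids-2-zero _ {u} _ ≤T = free 2 u (s≤s z≤n) (3≤q ≤T)

    module One = WithOffsets 1 (λ _ → 0) zero refl avoids-2-zero few-one (λ _ → refl)

  many-orbits : 2 ≤ T → InGR 2 σ
  many-orbits 2≤T = rigid⇒InGR two-coloured (λ u v → cong fromBool (E-σ u v)) λ τ aut →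
    let A = automorphism two-coloured toBool (λ u v → toBool-fromBool (E u v)) τ aut in
    rigid A (dihedral A)
    where
    open One
    rigid : (A : Automorphism E) → Dihedral A → ∃ λ s → ∀ u → Automorphism.to A u ≡ pow σ s u
    rigid A (inj₁ F) = rotation A F (synchronised A λ _ → refl)
    rigid A (inj₂ B) = contradiction e (no-forward-shift A {x} (ρ-vtx 0 z≤n) (B (ρ-vtx 0 z≤n)))
      where
      open Automorphism A
      x = rep 0
      u = π 1 x
      -- Now `π 1 y` is `σ u`, so `(u, y)` is an exceptional pair; its image forces a forward step
      -- in the first orbit.
      y = π 2 (σ ⟨$⟩ʳ x)
      2≤R = ≤-trans 2≤T T≤R
      q₁∣q₂ : q 1 ∣ q 2
      q₁∣q₂ = q-chain ≤-refl (s≤s z≤n) 2≤T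
      ρu : ρ u ≡ 1
      ρu = ρ-π x 1≤R
      ρy : ρ y ≡ 2
      ρy = ρ-π (σ ⟨$⟩ʳ x) 2≤R
      u<y : ρ u < ρ y
      u<y = subst₂ _<_ (sym ρu) (sym ρy) ≤-refl
      ρx : ρ x ≡ 0
      ρx = ρ-vtx 0 z≤n
      conclude : Exceptional (to u) (to y) → π 1 (to y) ≡ σ ⟨$⟩ʳ to u
      conclude (inj₁ (ρ0 , _)) = contradiction (trans (sym ρ0) (trans (rank-preserved A u) ρu)) λ ()
      conclude (inj₂ (_ , _ , _ , e)) = e
      sy : to y ≡ π 2 (to (σ ⟨$⟩ʳ x))
      sy = synchronised A (λ _ → refl) (s≤s z≤n) 2≤T (trans (ρ-σ x) ρx)
      su : to u ≡ π 1 (to x)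
      su = synchronised A (λ _ → refl) (s≤s z≤n) 1≤T ρx
      e : π 1 (to (σ ⟨$⟩ʳ x)) ≡ σ ⟨$⟩ʳ π 1 (to x)
      e = begin
        π 1 (to (σ ⟨$⟩ʳ x))        ≡⟨ sym (π-π _ 1≤R 2≤R q₁∣q₂) ⟩
        π 1 (π 2 (to (σ ⟨$⟩ʳ x)))  ≡⟨ cong (π 1) (sym sy) ⟩
        π 1 (to y)                 ≡⟨ conclude (exceptional
             (subst₂ _<_ (sym (rank-preserved A u)) (sym (rank-preserved A y)) u<y)
             (trans (to-pres u y λ u≡y → <⇒≢ u<y (cong ρ u≡y))
               (trans (E-exceptional u<y (inj₂ (ρu , ρy , 2≤T , trans (π-π _ 1≤R 2≤R q₁∣q₂) (π-σ x ρx 1≤R))))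
                 (cong ε (sym (rank-preserved A y)))))) ⟩
        σ ⟨$⟩ʳ to u                ≡⟨ cong (σ ⟨$⟩ʳ_) su ⟩
        σ ⟨$⟩ʳ π 1 (to x)          ∎
        where open ≡-Reasoning

  -- The third colour is given to pairs of offset 1, which are ordinary. Forgetting it recovers `E`,
  -- so the analysis of `E` applies to every automorphism, and the third colour only has to exclude
  -- reversals.
  three-colours : InGR 3 σ
  three-colours = rigid⇒InGR G col-σ rigid
    where
    open One
    Oriented : Fin m → Fin m → Set
    Oriented u v = ρ u ≡ 0 × ρ v ≡ 1 × π 1 u ≡ σ ⟨$⟩ʳ v
    oriented? : ∀ u v → Dec (Oriented u v)
    oriented? u v = (ρ u ≟ 0) ×-dec (ρ v ≟ 1) ×-dec (π 1 u Fin.≟ (σ ⟨$⟩ʳ v))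
    Third : Fin m → Fin m → Set
    Third u v = Oriented u v ⊎ Oriented v u
    third? : ∀ u v → Dec (Third u v)
    third? u v = oriented? u v ⊎-dec oriented? v u
    oriented-σ : ∀ {u v} → Oriented u v → Oriented (σ ⟨$⟩ʳ u) (σ ⟨$⟩ʳ v)
    oriented-σ {u} {v} (ρu , ρv , e) = trans (ρ-σ u) ρu , trans (ρ-σ v) ρv , trans (π-σ u ρu 1≤R) (cong (σ ⟨$⟩ʳ_) e)
    oriented-σ⁻ : ∀ {u v} → Oriented (σ ⟨$⟩ʳ u) (σ ⟨$⟩ʳ v) → Oriented u v
    oriented-σ⁻ {u} {v} (ρu , ρv , e) = trans (sym (ρ-σ u)) ρu , trans (sym (ρ-σ v)) ρv ,
      perm-injective σ (trans (sym (π-σ u (trans (sym (ρ-σ u)) ρu) 1≤R)) e)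
    colour : Bool → Bool → Fin 3
    colour true  _     = suc (suc zero)
    colour false true  = suc zero
    colour false false = zero
    G : ColoredGraph 3 m
    G = record { col = λ u v → colour (does (third? u v)) (E u v)
               ; sym = λ u v → cong₂ colour (does-⇔ (mk⇔ swap swap) (third? u v) (third? v u)) (E-sym u v) }
    open ColoredGraph G using (col)
    col-σ : ∀ u v → col (σ ⟨$⟩ʳ u) (σ ⟨$⟩ʳ v) ≡ col u v
    col-σ u v = cong₂ colour (does-⇔ (mk⇔ [ inj₁ ∘ oriented-σ⁻ , inj₂ ∘ oriented-σ⁻ ]′
      [ inj₁ ∘ oriented-σ , inj₂ ∘ oriented-σ ]′) (third? _ _) (third? u v)) (E-σ u v)
    oriented-E : ∀ {u v} → Oriented u v → E u v ≡ false
    oriented-E {u} {v} (ρu , ρv , e) = trans (E-ordinary (subst₂ _<_ (sym ρu) (sym ρv) ≤-refl) ordinary)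
        (cong (not ∘ ε) ρv)
      where
      ordinary : ¬ Exceptional u v
      ordinary (inj₁ (_ , _ , _ , e′)) = σ≢ 1 {v} ≤-refl (s≤s z≤n) (subst (_≤ T) (sym ρv) 1≤T)
        (trans (sym e′) (trans (cong (λ j → π j u) ρv) e))
      ordinary (inj₂ (ρu≡1 , _)) = contradiction (trans (sym ρu) ρu≡1) λ ()
    toBool-colour : ∀ b b′ → (b ≡ true → b′ ≡ false) → toBool (colour b b′) ≡ b′
    toBool-colour true  b′    h = sym (h refl)
    toBool-colour false true  h = refl
    toBool-colour false false h = refl
    colour-third : ∀ b b′ → colour b b′ ≡ suc (suc zero) → b ≡ true
    colour-third true  _     _ = refl
    colour-third false true  ()
    colour-third false false ()
    holds : ∀ {P : Set} (d : Dec P) → does d ≡ true → P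
    holds (yes p) _ = p
    decode : ∀ u v → toBool (col u v) ≡ E u v
    decode u v = toBool-colour (does (third? u v)) (E u v)
      ([ oriented-E , trans (E-sym u v) ∘ oriented-E ]′ ∘ holds (third? u v))
    third : ∀ u v → col u v ≡ suc (suc zero) → Third u v
    third u v e = holds (third? u v) (colour-third (does (third? u v)) (E u v) e)
    rigid : ∀ τ → IsAut G τ → InCyclic σ τ
    rigid τ aut = go (dihedral A)
      where
      A = automorphism G toBool decode τ aut
      open Automorphism A using (to)
      x = rep 0
      x′ = σ ⟨$⟩ʳ x
      u = π 1 x
      ρx : ρ x ≡ 0
      ρx = ρ-vtx 0 z≤n
      ρx′ : ρ x′ ≡ 0
      ρx′ = trans (ρ-σ x) ρx
      ρu : ρ u ≡ 1
      ρu = ρ-π x 1≤R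
      conclude : Third (to x′) (to u) → π 1 (to x′) ≡ σ ⟨$⟩ʳ (to u)
      conclude (inj₁ (_ , _ , e)) = e
      conclude (inj₂ (ρ0 , _)) = contradiction (trans (sym ρ0) (trans (rank-preserved A u) ρu)) λ ()
      go : Dihedral A → InCyclic σ τ
      go (inj₁ F) = rotation A F (synchronised A λ _ → refl)
      go (inj₂ B) = contradiction
        (trans (conclude (third (to x′) (to u) (trans (aut x′ u λ e → contradiction (trans (sym ρx′) (trans (cong ρ e) ρu)) λ ())
          (cong (λ b → colour b (E x′ u)) (dec-true (third? x′ u) (inj₁ (ρx′ , ρu , π-σ x ρx 1≤R)))))))
          (cong (σ ⟨$⟩ʳ_) (synchronised A (λ _ → refl) ≤-refl 1≤T ρx)))
        (no-forward-shift A {x} ρx (B ρx))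

  -- When q ≥ 7, no reflection of ℤ/q maps {0, 1, 3} to itself.
  asymmetric : Fin 3 → ℕ
  asymmetric zero             = 0
  asymmetric (suc zero)       = 1
  asymmetric (suc (suc zero)) = 3

  two-orbits : T ≡ 1 → 7 ≤ q 1 → (∀ M → N ≡ M * q 1 → 3 * M < K + K) → InGR 2 σ
  two-orbits T≡1 7≤q few = rigid⇒InGR two-coloured (λ u v → cong fromBool (E-σ u v)) λ τ aut →
    let A = automorphism two-coloured toBool (λ u v → toBool-fromBool (E u v)) τ aut in
    rigid A (dihedral A)
    where
    δ : Fin 3 → ℕ
    δ = asymmetric
    exp-inj : ∀ {u} {a b} → ρ u ≡ 1 → a < 7 → b < 7 → pow σ a u ≡ pow σ b u → a ≡ b
    exp-inj {u} {a} {b} ρu a<7 b<7 = exp-injective u (subst (λ j → a < q j) (sym ρu) (<-≤-trans a<7 7≤q))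
      (subst (λ j → b < q j) (sym ρu) (<-≤-trans b<7 7≤q))
    -- All sums of offsets that are compared stay below 7, so congruences modulo `q 1` become
    -- equations.
    below7 : ∀ i → 3 + δ i < 7
    below7 zero             = s≤s (s≤s (s≤s (s≤s z≤n)))
    below7 (suc zero)       = s≤s (s≤s (s≤s (s≤s (s≤s z≤n))))
    below7 (suc (suc zero)) = ≤-refl
    <7 : ∀ i → δ i < 7
    <7 i = ≤-<-trans (m≤n+m (δ i) 3) (below7 i)
    1+<7 : ∀ i → 1 + δ i < 7
    1+<7 i = ≤-<-trans (s≤s (m≤n+m (δ i) 2)) (below7 i)
    missing : ∀ i → 2 ≢ δ i
    missing zero ()
    missing (suc zero) ()
    missing (suc (suc zero)) ()
    avoids-2 : ∀ i {u} → 1 ≤ ρ u → ρ u ≤ T → pow σ 2 u ≢ pow σ (δ i) u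
    avoids-2 i {u} 1≤ ≤T e =
      missing i (exp-inj {u} (≤-antisym (subst (ρ u ≤_) T≡1 ≤T) 1≤) (s≤s (s≤s (s≤s z≤n))) (<7 i) e)
    vacuous : 2 ≤ T → 3 ≡ 1
    vacuous 2≤T = contradiction (subst (2 ≤_) T≡1 2≤T) λ { (s≤s ()) }
    open WithOffsets 3 δ zero refl avoids-2 few vacuous
    -- The images of the offsets 0, 1, 3 are `δ a`, `1 + δ a`, `3 + δ a`. Neither 1 + 1 nor 1 + 3 is
    -- an offset, so `δ a` is 0.
    forward-table : ∀ a b d → 1 + δ a ≡ δ b → 3 + δ a ≡ δ d → δ a ≡ 0
    forward-table zero             b d e e′ = refl
    forward-table (suc zero)       b d e e′ = contradiction e (missing b)
    forward-table (suc (suc zero)) zero d () e′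
    forward-table (suc (suc zero)) (suc zero) d () e′
    forward-table (suc (suc zero)) (suc (suc zero)) d () e′
    -- Under a reversal the images are `δ a`, `δ a - 1`, `δ a - 3`: the last forces `δ a` to be 3,
    -- and then the second is the missing offset 2.
    backward-table : ∀ a b d → 1 + δ b ≡ δ a → 3 + δ d ≡ δ a → ⊥
    backward-table a                zero             d e e′ with 3 + δ d | trans e′ (sym e) | m≤m+n 3 (δ d)
    ... | .1 | refl | s≤s ()
    backward-table a                (suc zero)       d e e′ = missing a e
    backward-table zero             (suc (suc zero)) d () e′
    backward-table (suc zero)       (suc (suc zero)) d () e′
    backward-table (suc (suc zero)) (suc (suc zero)) d () e′
    module _ (A : Automorphism E) where
      open Automorphism A
      image : ∀ {u v} → ρ u ≡ 1 → ρ v ≡ 0 → π 1 v ≡ u → ∀ i → ∃ λ a → π 1 (to (pow σ (δ i) v)) ≡ pow σ (δ a) (to u)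
      image {u} {v} ρu ρv e i = sync-preserved A ≤-refl 1≤T ρu (trans (ρ-pow (δ i) v) ρv)
        (i , trans (π-pow (δ i) v 1≤R (q-top-ρ ρv 1≤R)) (cong (pow σ (δ i)) e))
      ρ-to₁ : ∀ {u} → ρ u ≡ 1 → ρ (to u) ≡ 1
      ρ-to₁ {u} ρu = trans (rank-preserved A u) ρu
      synchronised₁ : (∀ {x} → ρ x ≡ 0 → Forward A x) → Synchronised A
      synchronised₁ F {j} {v} 1≤j j≤T ρv with ≤-antisym (subst (j ≤_) T≡1 j≤T) 1≤j
      ... | refl with image (ρ-π v 1≤R) ρv refl zero | image (ρ-π v 1≤R) ρv refl (suc zero) | image (ρ-π v 1≤R) ρv refl (suc (suc zero))
      ... | a , ea | b , eb | d , ed = sym (trans ea (cong (λ t → pow σ t (to u)) (forward-table a b d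
              (exp-inj (ρ-to₁ ρu) (1+<7 a) (<7 b) (trans (sym (shifted 1 (F ρv))) eb))
              (exp-inj (ρ-to₁ ρu) (below7 a) (<7 d) (trans (sym (shifted 3 F³)) ed)))))
        where
        u = π 1 v
        ρu : ρ u ≡ 1
        ρu = ρ-π v 1≤R
        F³ : to (pow σ 3 v) ≡ pow σ 3 (to v)
        F³ = trans (F (trans (ρ-pow 2 v) ρv)) (cong (σ ⟨$⟩ʳ_) (trans (F (trans (ρ-σ v) ρv)) (cong (σ ⟨$⟩ʳ_) (F ρv))))
        shifted : ∀ t → to (pow σ t v) ≡ pow σ t (to v) → π 1 (to (pow σ t v)) ≡ pow σ (t + δ a) (to u)
        shifted t e = trans (cong (π 1) e) (trans (π-pow t (to v) 1≤R (q-top-ρ (ρ-to A ρv) 1≤R))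
          (trans (cong (pow σ t) ea) (sym (pow-+ σ t (δ a) (to u)))))
      no-backward : ¬ (∀ {x} → ρ x ≡ 0 → Backward A x)
      no-backward B with image (ρ-π v 1≤R) ρv refl zero | image (ρ-π v 1≤R) ρv refl (suc zero) | image (ρ-π v 1≤R) ρv refl (suc (suc zero))
        where
        v = rep 0
        ρv : ρ v ≡ 0
        ρv = ρ-vtx 0 z≤n
      ... | a , ea | b , eb | d , ed = backward-table a b d
              (exp-inj (ρ-to₁ ρu) (1+<7 b) (<7 a) (shifted 1 (δ b) (B ρv) eb))
              (exp-inj (ρ-to₁ ρu) (below7 d) (<7 a) (shifted 3 (δ d) B³ ed))
        where
        v = rep 0
        ρv : ρ v ≡ 0
        ρv = ρ-vtx 0 z≤n
        u = π 1 v
        ρu : ρ u ≡ 1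
        ρu = ρ-π v 1≤R
        B³ : pow σ 3 (to (pow σ 3 v)) ≡ to v
        B³ = trans (cong (pow σ 2) (B (trans (ρ-pow 2 v) ρv))) (trans (cong (pow σ 1) (B (trans (ρ-σ v) ρv))) (B ρv))
        shifted : ∀ t e → pow σ t (to (pow σ t v)) ≡ to v → π 1 (to (pow σ t v)) ≡ pow σ e (to u) →
          pow σ (t + e) (to u) ≡ pow σ (δ a) (to u)
        shifted t e back im = trans (pow-+ σ t e (to u)) (trans (cong (pow σ t) (sym im))
          (trans (sym (π-pow t (to (pow σ t v)) 1≤R (q-top-ρ (ρ-to A (trans (ρ-pow t v) ρv)) 1≤R)))
          (trans (cong (π 1) back) ea)))
      rigid : Dihedral A → ∃ λ s → ∀ u → to u ≡ pow σ s u
      rigid (inj₁ F) = rotation A F (synchronised₁ F)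
      rigid (inj₂ B) = contradiction (λ {x} → B {x}) (no-backward)

-- Non-membership

power : ∀ {m} → Permutation′ m → ℕ → Permutation′ m
power σ zero    = id
power σ (suc t) = power σ t ∘ₚ σ

power-pow : ∀ {m} (σ : Permutation′ m) t x → power σ t ⟨$⟩ʳ x ≡ pow σ t x
power-pow σ zero    x = refl
power-pow σ (suc t) x = cong (σ ⟨$⟩ʳ_) (power-pow σ t x)

module Reflection {m} {σ : Permutation′ m} (S : OrbitSystem σ) (e : ℕ → ℕ) where
  open OrbitSystem S

  -- On the orbit of rank `i` this is t ↦ e(i) - t, with `N ∸ c u` for minus `c u`. The constant can
  -- be chosen separately for each orbit.
  reflect : Fin m → Fin m
  reflect u = vtx (ρ u) (e (ρ u) + (N ∸ c u))

  wrap : ∀ s i a → s ≤ N → pow σ s (vtx i (a + (N ∸ s))) ≡ vtx i a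
  wrap s i a s≤N = begin
    pow σ s (vtx i (a + (N ∸ s)))  ≡⟨ shift s i _ ⟩
    vtx i (s + (a + (N ∸ s)))      ≡⟨ cong (vtx i) (trans (cong (s +_) (+-comm a _)) (trans (sym (+-assoc s _ a)) (cong (_+ a) (m+[n∸m]≡n s≤N)))) ⟩
    vtx i (N + a)                  ≡⟨ sym (shift N i a) ⟩
    pow σ N (vtx i a)              ≡⟨ powN (vtx i a) ⟩
    vtx i a                        ∎
    where open ≡-Reasoning

  c≤N : ∀ u → c u ≤ N
  c≤N u = <⇒≤ (<-≤-trans (c<q u) (∣⇒≤ {{>-nonZero (≤-trans (s≤s z≤n) (3≤q z≤n))}} (q-top (ρ≤R u))))

  unwind : ∀ u → pow σ (c u) (reflect u) ≡ vtx (ρ u) (e (ρ u))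
  unwind u = wrap (c u) (ρ u) (e (ρ u)) (c≤N u)

  ρ-reflect : ∀ u → ρ (reflect u) ≡ ρ u
  ρ-reflect u = ρ-vtx (e (ρ u) + (N ∸ c u)) (ρ≤R u)

  -- The equation t + (e(i) - t) = e(i), free of subtraction and valid for every exponent `t` of the
  -- vertex, not only for its coordinate.
  reflect-vtx : ∀ {i} t → i ≤ R → pow σ t (reflect (vtx i t)) ≡ vtx i (e i)
  reflect-vtx {i} t i≤R = begin
    pow σ t (reflect v)             ≡⟨ cong (pow σ t ∘ (λ k → vtx k s)) (ρ-vtx t i≤R) ⟩
    pow σ t (vtx i s)               ≡⟨ pow-comm σ t s (rep i) ⟩
    pow σ s (vtx i t)               ≡⟨ cong (pow σ s) (sym (trans (cong (λ k → vtx k (c v)) (sym (ρ-vtx t i≤R))) (vtx-c v))) ⟩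
    pow σ s (vtx i (c v))           ≡⟨ pow-comm σ s (c v) (rep i) ⟩
    pow σ (c v) (vtx i s)           ≡⟨ cong (pow σ (c v) ∘ (λ k → vtx k s)) (sym (ρ-vtx t i≤R)) ⟩
    pow σ (c v) (reflect v)         ≡⟨ unwind v ⟩
    vtx (ρ v) (e (ρ v))             ≡⟨ cong (λ k → vtx k (e k)) (ρ-vtx t i≤R) ⟩
    vtx i (e i)                     ∎
    where
    open ≡-Reasoning
    v = vtx i t
    s = e (ρ v) + (N ∸ c v)

  reflect-involutive : ∀ u → reflect (reflect u) ≡ u
  reflect-involutive u = pow-injective σ s (trans (reflect-vtx s (ρ≤R u)) (sym (begin
    pow σ s u                ≡⟨ cong (pow σ s) (sym (vtx-c u)) ⟩
    pow σ s (vtx (ρ u) (c u)) ≡⟨ pow-comm σ s (c u) _ ⟩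
    pow σ (c u) (reflect u)  ≡⟨ unwind u ⟩
    vtx (ρ u) (e (ρ u))      ∎)))
    where
    open ≡-Reasoning
    s = e (ρ u) + (N ∸ c u)

  reflection : Permutation′ m
  reflection = permutation reflect reflect reflect-involutive reflect-involutive

  -- The reflection fixes `rep 0`, so a power of `σ` equal to it would fix the main orbit pointwise;
  -- but exponent 1 goes to -1, and `N` is at least 3.
  not-cyclic : e 0 ≡ 0 → ¬ InCyclic σ reflection
  not-cyclic e₀ (j , h) = free 2 (rep 0) (s≤s z≤n) (subst (λ i → 2 < q i) (sym (ρ-vtx 0 z≤n)) (3≤q z≤n)) (begin
    pow σ 1 (vtx 0 1)           ≡⟨ cong (pow σ 1) (sym (fix-pow σ j 1 (rep 0) j-fix)) ⟩
    pow σ 1 (pow σ j (vtx 0 1)) ≡⟨ cong (pow σ 1) (sym (h (vtx 0 1))) ⟩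
    pow σ 1 (reflect (vtx 0 1)) ≡⟨ reflect-vtx 1 z≤n ⟩
    vtx 0 (e 0)                 ≡⟨ cong (vtx 0) e₀ ⟩
    rep 0                       ∎)
    where
    open ≡-Reasoning
    j-fix : pow σ j (rep 0) ≡ rep 0
    j-fix = trans (sym (h (rep 0))) (trans (reflect-vtx 0 z≤n) (cong (vtx 0) e₀))

  module _ {k} (G : ColoredGraph k m) (equiv : ∀ τ → InCyclic σ τ → IsAut G τ) where
    open ColoredGraph G using (col)

    invariant : ∀ t u v → u ≢ v → col (pow σ t u) (pow σ t v) ≡ col u v
    invariant t u v u≢v = trans (cong₂ col (sym (power-pow σ t u)) (sym (power-pow σ t v)))
      (equiv (power σ t) (t , power-pow σ t) u v u≢v)

    -- Both vertices move by `s + t`, with `s` absorbed in `u′` and `t` in `v′`. This clears the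
    -- subtracted exponents of two reflected vertices at once.
    invariant₂ : ∀ s t u v {u′ v′} → u ≢ v → pow σ s u ≡ u′ → pow σ t v ≡ v′ → col (pow σ t u′) (pow σ s v′) ≡ col u v
    invariant₂ s t u v u≢v refl refl = trans (cong₂ col (sym (pow-+ σ t s u)) (trans (pow-comm σ s t v) (sym (pow-+ σ t s v))))
      (invariant (t + s) u v u≢v)

    private
      ≢-rank : ∀ {u v} → ρ u < ρ v → u ≢ v
      ≢-rank lt refl = <-irrefl refl lt

      to-base : ∀ {u v} → ρ u < ρ v → T < ρ v → col u v ≡ col (rep (ρ u)) v
      to-base {u} {v} u<v T<v = trans (cong₂ col (sym (vtx-c u)) (sym (v-fixed (c u))))
        (invariant (c u) (rep (ρ u)) v (≢-rank (subst (_< ρ v) (sym (ρ-vtx 0 (ρ≤R u))) u<v)))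
        where
        v-fixed : ∀ t → pow σ t v ≡ v
        v-fixed t = ∣⇒fix t v (subst (_∣ t) (sym (q-fixed T<v (ρ≤R v))) (1∣ t))

      -- A fixed point has a single colour to each whole orbit, and a reflection preserves orbits.
      cross-fixed : ∀ {u v} → ρ u < ρ v → T < ρ v → col (reflect u) (reflect v) ≡ col u v
      cross-fixed {u} {v} u<v T<v = trans (cong (col (reflect u)) (sym (fixed-unique T<v (sym (ρ-reflect v)))))
        (trans (to-base (subst (_< ρ v) (sym (ρ-reflect u)) u<v) T<v)
        (trans (cong (λ i → col (rep i) v) (ρ-reflect u)) (sym (to-base u<v T<v))))

      reflect-≢ : ∀ {u v} → u ≢ v → reflect u ≢ reflect v
      reflect-≢ u≢v eq = u≢v (trans (sym (reflect-involutive _)) (trans (cong reflect eq) (reflect-involutive _)))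

    -- Inside an orbit a reflection changes the sign of the difference of two exponents, which a
    -- colouring of unordered pairs cannot see. Only pairs from different nontrivial orbits are left
    -- to the hypothesis.
    reflection-aut : (∀ {u v} → ρ u < ρ v → ρ v ≤ T → col (reflect u) (reflect v) ≡ col u v) → IsAut G reflection
    reflection-aut cross u v u≢v with <-cmp (ρ u) (ρ v)
    ... | tri< u<v _ _ = go u<v
      where
      go : ρ u < ρ v → col (reflect u) (reflect v) ≡ col u v
      go u<v with ρ v ≤? T
      ... | yes v≤T = cross u<v v≤T
      ... | no v≰T  = cross-fixed u<v (≰⇒> v≰T)
    ... | tri> _ _ v<u = trans (ColoredGraph.sym G _ _) (trans go (ColoredGraph.sym G v u))
      where
      go : col (reflect v) (reflect u) ≡ col v u
      go with ρ u ≤? T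
      ... | yes u≤T = cross v<u u≤T
      ... | no u≰T  = cross-fixed v<u (≰⇒> u≰T)
    ... | tri≈ _ u≡v _ = begin
      col (reflect u) (reflect v)
        ≡⟨ sym (invariant₂ (c u) (c v) (reflect u) (reflect v) (reflect-≢ u≢v) (unwind u) (unwind v)) ⟩
      col (pow σ (c v) (vtx (ρ u) (e (ρ u)))) (pow σ (c u) (vtx (ρ v) (e (ρ v))))
        ≡⟨ cong₂ col (cong (λ i → pow σ (c v) (vtx i (e i))) u≡v) (cong (λ i → pow σ (c u) (vtx i (e i))) (sym u≡v)) ⟩
      col (pow σ (c v) (vtx (ρ v) (e (ρ v)))) (pow σ (c u) (vtx (ρ u) (e (ρ u))))
        ≡⟨ cong₂ col (past v) (trans (past u) (cong (λ i → pow σ (e i) u) u≡v)) ⟩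
      col (pow σ (e (ρ v)) v) (pow σ (e (ρ v)) u)
        ≡⟨ invariant (e (ρ v)) v u (u≢v ∘ sym) ⟩
      col v u
        ≡⟨ ColoredGraph.sym G v u ⟩
      col u v ∎
      where
      open ≡-Reasoning
      past : ∀ w → pow σ (c w) (vtx (ρ w) (e (ρ w))) ≡ pow σ (e (ρ w)) w
      past w = trans (pow-comm σ (c w) (e (ρ w)) _) (cong (pow σ (e (ρ w))) (vtx-c w))

-- Invariance of `g` under the reflection x ↦ d - x of ℤ/p.
HasCentre : ∀ {p} .{{_ : NonZero p}} → (Fin p → Fin 2) → Set
HasCentre {p} g = ∃ λ (d : Fin p) → ∀ x y → (toℕ x + toℕ y) % p ≡ toℕ d → g x ≡ g y

module _ {p} .{{_ : NonZero p}} where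
  hasCentre? : (g : Fin p → Fin 2) → Dec (HasCentre g)
  hasCentre? g = any? λ d → all? λ x → all? λ y → (_ ≟ _) →-dec (g x Fin.≟ g y)

  hasCentre-resp : ∀ {g h : Fin p → Fin 2} → (∀ x → g x ≡ h x) → HasCentre g → HasCentre h
  hasCentre-resp eq (d , f) = d , λ x y s → trans (sym (eq x)) (trans (f x y s) (eq y))

-- Among at most five residues one of the two colour classes has at most two elements, and such a
-- set is symmetric about its midpoint. The finitely many value vectors are checked by decision.
has-centre₃ : (g : Fin 3 → Fin 2) → HasCentre g
has-centre₃ g = hasCentre-resp (lookup∘tabulate g) (check _ _ _)
  where
  check : ∀ a b d → HasCentre (lookup (a ∷ b ∷ d ∷ []))
  check = from-yes (all? λ a → all? λ b → all? λ d → hasCentre? (lookup (a ∷ b ∷ d ∷ [])))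

has-centre₅ : (g : Fin 5 → Fin 2) → HasCentre g
has-centre₅ g = hasCentre-resp (lookup∘tabulate g) (check _ _ _ _ _)
  where
  check : ∀ a b d e f → HasCentre (lookup (a ∷ b ∷ d ∷ e ∷ f ∷ []))
  check = from-yes (all? λ a → all? λ b → all? λ d → all? λ e → all? λ f → hasCentre? (lookup (a ∷ b ∷ d ∷ e ∷ f ∷ [])))

module NonMembership {m} {σ : Permutation′ m} (S : OrbitSystem σ) where
  open OrbitSystem S

  single-orbit : T ≡ 0 → ¬ InGRany σ
  single-orbit T≡0 (k , G , equiv) = not-cyclic refl (Equivalence.to (equiv reflection)
    (reflection-aut G (Equivalence.from ∘ equiv) λ {u} {v} u<v v≤T →
      contradiction (<-≤-trans u<v (subst (ρ v ≤_) T≡0 v≤T)) λ ()))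
    where open Reflection S (λ _ → 0)

  -- By invariance the colour between exponents s and t is a function `g` of t - s. Sending s to -s
  -- and t to d - t turns t - s into d - (t - s), where `g` has the same value if d is its centre.
  symmetric-pair : ∀ {p} .{{_ : NonZero p}} → T ≡ 1 → q 1 ≡ p → (∀ (g : Fin p → Fin 2) → HasCentre g) → ¬ InGR 2 σ
  symmetric-pair {p} T≡1 q≡p centre (G , equiv) = not-cyclic refl (Equivalence.to (equiv reflection)
      (reflection-aut G (Equivalence.from ∘ equiv) cross))
    where
    open ColoredGraph G using (col)
    g : Fin p → Fin 2
    g x = col (rep 0) (vtx 1 (toℕ x))
    d = proj₁ (centre g)
    e : ℕ → ℕ
    e zero    = 0
    e (suc _) = toℕ d
    open Reflection S e
    1≤R : 1 ≤ R
    1≤R = subst (_≤ R) T≡1 T≤R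
    inv = invariant G (Equivalence.from ∘ equiv)
    inv₂ = invariant₂ G (Equivalence.from ∘ equiv)
    main≢ : ∀ s t → vtx 0 s ≢ vtx 1 t
    main≢ s t eq = contradiction (trans (sym (ρ-vtx s z≤n)) (trans (cong ρ eq) (ρ-vtx t 1≤R))) λ ()
    residue : ∀ t → ∃ λ (x : Fin p) → vtx 1 (toℕ x) ≡ vtx 1 t
    residue t = fromℕ< lt , trans (cong (vtx 1) (toℕ-fromℕ< lt))
        (trans (cong (λ i → vtx i (c (vtx 1 t))) (sym (ρ-vtx t 1≤R))) (vtx-c (vtx 1 t)))
      where
      lt : c (vtx 1 t) < p
      lt = subst (c (vtx 1 t) <_) (trans (cong q (ρ-vtx t 1≤R)) q≡p) (c<q (vtx 1 t))
    small : ∀ {x} → x < p → x < q (ρ (rep 1))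
    small = subst (_ <_) (sym (trans (cong q (ρ-vtx 0 1≤R)) q≡p))
    cross′ : ∀ s t {u v} → u ≡ vtx 0 s → v ≡ vtx 1 t → s ≤ N → col (reflect u) (reflect v) ≡ col u v
    -- `x` is the residue of t - s, and `y` will be that of d - x.
    cross′ s t refl refl s≤N with residue (t + (N ∸ s))
    ... | x , ex with residue (toℕ d + (N ∸ toℕ x))
    ... | y , ey = begin
      col (reflect (vtx 0 s)) (reflect (vtx 1 t))
        ≡⟨ sym (inv₂ s t (reflect (vtx 0 s)) (reflect (vtx 1 t)) reflect≢ (reflect-vtx s z≤n) (reflect-vtx t 1≤R)) ⟩
      col (vtx 0 t) (pow σ s (vtx 1 (toℕ d)))
        ≡⟨ cong (col (vtx 0 t)) (trans (cong (pow σ s) (sym x+y)) (trans (pow-comm σ s (toℕ y) _)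
             (trans (cong (pow σ (toℕ y)) x+s) (pow-comm σ (toℕ y) t (rep 1))))) ⟩
      col (vtx 0 t) (pow σ t (vtx 1 (toℕ y)))
        ≡⟨ inv t (rep 0) (vtx 1 (toℕ y)) (main≢ 0 (toℕ y)) ⟩
      g y
        ≡⟨ sym (proj₂ (centre g) x y (exp-injective (rep 1) (small (m%n<n _ p)) (small (toℕ<n d))
             (trans (sym (pow-% σ (toℕ x + toℕ y) p (subst (λ k → pow σ k (rep 1) ≡ rep 1) q≡p (period 1≤R))))
                    (trans (cong (vtx 1) (+-comm (toℕ x) (toℕ y))) (trans (sym (shift (toℕ y) 1 (toℕ x))) x+y))))) ⟩
      g x
        ≡⟨ sym (inv s (rep 0) (vtx 1 (toℕ x)) (main≢ 0 (toℕ x))) ⟩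
      col (vtx 0 s) (pow σ s (vtx 1 (toℕ x)))
        ≡⟨ cong (col (vtx 0 s)) x+s ⟩
      col (vtx 0 s) (vtx 1 t) ∎
      where
      open ≡-Reasoning
      x+s : pow σ s (vtx 1 (toℕ x)) ≡ vtx 1 t
      x+s = trans (cong (pow σ s) ex) (wrap s 1 t s≤N)
      x≤N : toℕ x ≤ N
      x≤N = <⇒≤ (<-≤-trans (subst (toℕ x <_) (sym q≡p) (toℕ<n x)) (∣⇒≤ {{>-nonZero (≤-trans (s≤s z≤n) (3≤q z≤n))}} (q-top 1≤R)))
      x+y : pow σ (toℕ y) (vtx 1 (toℕ x)) ≡ vtx 1 (toℕ d)
      x+y = trans (pow-comm σ (toℕ y) (toℕ x) (rep 1)) (trans (cong (pow σ (toℕ x)) ey) (wrap (toℕ x) 1 (toℕ d) x≤N))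
      reflect≢ : reflect (vtx 0 s) ≢ reflect (vtx 1 t)
      reflect≢ eq = contradiction (trans (sym (trans (ρ-reflect _) (ρ-vtx s z≤n))) (trans (cong ρ eq) (trans (ρ-reflect _) (ρ-vtx t 1≤R)))) λ ()
    cross : ∀ {u v} → ρ u < ρ v → ρ v ≤ T → col (reflect u) (reflect v) ≡ col u v
    cross {u} {v} u<v v≤T = cross′ (c u) (c v)
        (trans (sym (vtx-c u)) (cong (λ i → vtx i (c u)) (n<1⇒n≡0 (<-≤-trans u<v v≤1))))
        (trans (sym (vtx-c v)) (cong (λ i → vtx i (c v)) (≤-antisym v≤1 (≤-trans (s≤s z≤n) u<v))))
        (c≤N u)
      where
      v≤1 : ρ v ≤ 1
      v≤1 = subst (ρ v ≤_) T≡1 v≤T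

-- Orbit coordinates from the numbers of orbits

least : ∀ {P : ℕ → Set} → (∀ t → Dec (P t)) → ∀ {n} → P n → ∃ λ s → P s × (∀ {t} → t < s → ¬ P t)
least {P} P? {n} Pn = [ (λ none → n , Pn , none) , (λ r → r) ]′ (search n)
  where
  search : ∀ b → (∀ {t} → t < b → ¬ P t) ⊎ (∃ λ s → P s × (∀ {t} → t < s → ¬ P t))
  search zero = inj₁ λ ()
  search (suc b) with search b | P? b
  ... | inj₂ r    | _      = inj₂ r
  ... | inj₁ none | yes Pb = inj₂ (b , Pb , none)
  ... | inj₁ none | no ¬Pb = inj₁ λ t<sb Pt → [ (λ t<b → none t<b Pt) , (λ { refl → ¬Pb Pt }) ]′ (m≤n⇒m<n∨m≡n (≤-pred t<sb))

∣-prime-power : ∀ {p} → Prime p → ∀ n {d} → d ∣ p ^ n → ∃ λ i → i ≤ n × d ≡ p ^ i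
∣-prime-power pr zero d∣1 = 0 , z≤n , ∣1⇒≡1 d∣1
∣-prime-power {p} pr (suc n) {d} d∣ with p ∣? d
... | yes (divides e refl) with ∣-prime-power pr n {e} (*-cancelˡ-∣ p {{prime⇒nonZero pr}} (subst (_∣ p * p ^ n) (*-comm e p) d∣))
... | i , i≤n , refl = suc i , s≤s i≤n , *-comm (p ^ i) p
∣-prime-power {p} pr (suc n) {d} d∣ | no p∤d with ∣-prime-power pr n {d} (coprime-divisor coprime d∣)
  where
  coprime : Coprime d p
  coprime {i} (i∣d , i∣p) = [ (λ e → e) , (λ { refl → contradiction i∣d p∤d }) ]′ (prime⇒irreducible pr i∣p)
... | i , i≤n , e = i , m≤n⇒m≤1+n i≤n , e

module _ {A : Set} where
  -- The default makes representatives a total function of the rank; the fields of the orbit system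
  -- constrain it only at ranks within the list.
  nth : A → List A → ℕ → A
  nth a []       _       = a
  nth a (x ∷ xs) zero    = x
  nth a (x ∷ xs) (suc i) = nth a xs i

  nth-all : ∀ {P : A → Set} {a xs i} → All P xs → i < length xs → P (nth a xs i)
  nth-all {i = zero}  (p ∷ ps) _         = p
  nth-all {i = suc i} (p ∷ ps) (s≤s i<n) = nth-all ps i<n

  nth-allPairs : ∀ {P : A → A → Set} {a xs i j} → AllPairs P xs → i < j → j < length xs → P (nth a xs i) (nth a xs j)
  nth-allPairs {i = zero}  {suc j} (p ∷ ps) _         (s≤s j<n) = nth-all p j<n
  nth-allPairs {i = suc i} {suc j} (p ∷ ps) (s≤s i<j) (s≤s j<n) = nth-allPairs ps i<j j<n

  nth-any : ∀ {P : A → Set} {a xs} → Any P xs → ∃ λ i → i < length xs × P (nth a xs i)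
  nth-any (here p) = 0 , s≤s z≤n , p
  nth-any (there ps) with nth-any ps
  ... | i , i<n , p = suc i , s≤s i<n , p

  nth-++ˡ : ∀ {a i} xs {ys} → i < length xs → nth a (xs ++ ys) i ≡ nth a xs i
  nth-++ˡ {i = zero}  (x ∷ xs) _         = refl
  nth-++ˡ {i = suc i} (x ∷ xs) (s≤s i<n) = nth-++ˡ xs i<n

  nth-++ʳ : ∀ {P : A → Set} {a i} xs {ys} → All P ys → length xs ≤ i → i < length (xs ++ ys) → P (nth a (xs ++ ys) i)
  nth-++ʳ              []       ps _         i<n       = nth-all ps i<n
  nth-++ʳ {i = suc i} (x ∷ xs) ps (s≤s n≤i) (s≤s i<n) = nth-++ʳ xs ps n≤i i<n

  allPairs-with : ∀ {P : A → Set} {Q S : A → A → Set} → (∀ {x y} → P x → P y → Q x y → S x y) →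
    ∀ {xs} → All P xs → AllPairs Q xs → AllPairs S xs
  allPairs-with f []       []       = []
  allPairs-with f (p ∷ ps) (q ∷ qs) = All.zipWith (λ (p′ , q′) → f p p′ q′) (ps , q) ∷ allPairs-with f ps qs

-- Order, periods and orbit sizes of a permutation

module Order {m} {σ : Permutation′ m} {N : ℕ} (co : CyclicOrder σ N) where

  -- Exponents can be reduced modulo `d`, which injects the `N` group elements into `Fin d`.
  order-minimal : ∀ d → 0 < d → (∀ x → pow σ d x ≡ x) → N ≤ d
  order-minimal d 0<d fix = injective⇒≤ {f = g} λ {i} {j} e → f-inj i j λ x →
      trans (reduce i x) (trans (cong (λ t → pow σ t x) (fromℕ<-injective _ _ (m%n<n (exp i) d) (m%n<n (exp j) d) e)) (sym (reduce j x)))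
    where
    instance
      d≢0 : NonZero d
      d≢0 = >-nonZero 0<d
    f = proj₁ co
    f-inj = proj₁ (proj₂ (proj₂ co))
    exp : Fin N → ℕ
    exp i = proj₁ (proj₁ (proj₂ co) i)
    reduce : ∀ i x → f i ⟨$⟩ʳ x ≡ pow σ (exp i % d) x
    reduce i x = trans (proj₂ (proj₁ (proj₂ co) i) x) (pow-% σ (exp i) d (fix x))
    g : Fin N → Fin d
    g i = fromℕ< (m%n<n (exp i) d)

  -- Two of the powers with exponents 0, ..., N coincide. The difference of their exponents is at
  -- most `N`, and at least `N` by minimality.
  order-fixes : ∀ x → pow σ N x ≡ x
  order-fixes with pigeonhole (n<1+n N) (λ i → proj₁ (proj₂ (proj₂ (proj₂ co)) (power σ (toℕ i)) (toℕ i , power-pow σ (toℕ i))))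
  ... | i , j , i<j , e = λ x → subst (λ t → pow σ t x ≡ x) d≡N (fix x)
    where
    d = toℕ j ∸ toℕ i
    h = proj₂ (proj₂ (proj₂ co))
    is : ∀ t x → pow σ t x ≡ proj₁ co (proj₁ (h (power σ t) (t , power-pow σ t))) ⟨$⟩ʳ x
    is t x = trans (sym (power-pow σ t x)) (proj₂ (h (power σ t) (t , power-pow σ t)) x)
    fix : ∀ x → pow σ d x ≡ x
    fix x = pow-cancel σ (<⇒≤ i<j) (trans (is (toℕ i) x) (trans (cong (λ k → proj₁ co k ⟨$⟩ʳ x) e) (sym (is (toℕ j) x))))
    d≡N : d ≡ N
    d≡N = ≤-antisym (≤-trans (m∸n≤m (toℕ j) (toℕ i)) (≤-pred (toℕ<n j))) (order-minimal d (m<n⇒0<n∸m i<j) fix)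

  order-positive : 0 < N
  order-positive = n≢0⇒n>0 λ N≡0 → Fin.¬Fin0 (subst Fin N≡0
    (proj₁ (proj₂ (proj₂ (proj₂ co)) (power σ 0) (0 , power-pow σ 0))))

module Periods {m} (σ : Permutation′ m) (N : ℕ) (0<N : 0 < N) (powN : ∀ x → pow σ N x ≡ x) where

  record Period (v : Fin m) (s : ℕ) : Set where
    field
      positive : 0 < s
      fixes    : pow σ s v ≡ v
      minimal  : ∀ d → pow σ d v ≡ v → s ∣ d

  open Period

  abstract
    has-period : ∀ v → ∃ (Period v)
    has-period v with least (λ s → (0 <? s) ×-dec (pow σ s v Fin.≟ v)) (0<N , powN v)
    ... | s , (0<s , fix) , min = s , record { positive = 0<s ; fixes = fix ; minimal = λ d e → m%n≡0⇒n∣m d s {{>-nonZero 0<s}} (rem d e) }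
      where
      rem : ∀ d → pow σ d v ≡ v → (d % s) {{>-nonZero 0<s}} ≡ 0
      rem d e with (d % s) {{>-nonZero 0<s}} in eq
      ... | zero  = refl
      ... | suc r = contradiction (s≤s z≤n , trans (cong (λ t → pow σ t v) (sym eq))
                      (trans (sym (pow-% σ d s {{>-nonZero 0<s}} fix)) e))
                      (min (subst (_< s) eq (m%n<n d s {{>-nonZero 0<s}})))

  period-unique : ∀ {v s t} → Period v s → Period v t → s ≡ t
  period-unique P Q = ∣-antisym (minimal P _ (fixes Q)) (minimal Q _ (fixes P))

  per : Fin m → ℕ
  per v = proj₁ (has-period v)

  per-period : ∀ v → Period v (per v)
  per-period v = proj₂ (has-period v)

  per-unique : ∀ {v s} → Period v s → per v ≡ s
  per-unique {v} P = period-unique (per-period v) P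

  per∣N : ∀ v → per v ∣ N
  per∣N v = minimal (per-period v) N (powN v)

  period-≢0 : ∀ {v s} → Period v s → NonZero s
  period-≢0 P = >-nonZero (positive P)

  per-pow : ∀ t v → per (pow σ t v) ≡ per v
  per-pow t v = per-unique record
    { positive = positive P ; fixes = fix-pow σ (per v) t v (fixes P) ; minimal = λ d → minimal P d ∘ fix-pow⁻ σ d t v }
    where P = per-period v

  per-orbit : ∀ {x y} → InOrbit σ x y → per x ≡ per y
  per-orbit {x} (t , refl) = sym (per-pow t x)

  orbit-sym : ∀ {x y} → InOrbit σ x y → InOrbit σ y x
  -- Minus `t`, made a natural number by adding `t * N`.
  orbit-sym {x} (t , refl) = t * N ∸ t , sym (trans (sym (pow-+ σ (t * N ∸ t) t x))
    (trans (cong (λ s → pow σ s x) (m∸n+n≡m (m≤m*n t N {{>-nonZero 0<N}}))) (pow-*-fix σ t (powN x))))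

  orbit-trans : ∀ {x y z} → InOrbit σ x y → InOrbit σ y z → InOrbit σ x z
  orbit-trans {x} (s , refl) (t , refl) = t + s , sym (pow-+ σ t s x)

  orbit-reduce : ∀ {x y} → InOrbit σ x y → ∃ λ t → t < per x × pow σ t x ≡ y
  orbit-reduce {x} (t , refl) = t % per x , m%n<n t (per x) , sym (pow-% σ t (per x) (fixes (per-period x)))
    where instance _ = period-≢0 (per-period x)

  private
    orbit-map-injective : ∀ {v s a b} → Period v s → a < s → b < s → a ≤ b → pow σ a v ≡ pow σ b v → a ≡ b
    orbit-map-injective {v} {s} {a} {b} P a<s b<s a≤b e with m≤n⇒m<n∨m≡n a≤b
    ... | inj₂ eq  = eq
    ... | inj₁ a<b = contradiction (∣⇒≤ {{>-nonZero (m<n⇒0<n∸m a<b)}} (minimal P (b ∸ a) (pow-cancel σ a≤b e)))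
                       (<⇒≱ (≤-<-trans (m∸n≤m b a) b<s))

  per-orbitSize : ∀ v → OrbitSize σ v (per v)
  per-orbitSize v = (λ i → pow σ (toℕ i) v) , inj , (λ i → toℕ i , refl) , λ y o →
      let t , t<s , e = orbit-reduce o in fromℕ< t<s , sym (trans (cong (λ k → pow σ k v) (toℕ-fromℕ< t<s)) e)
    where
    P = per-period v
    inj : ∀ i j → pow σ (toℕ i) v ≡ pow σ (toℕ j) v → i ≡ j
    inj i j e = toℕ-injective ([ (λ i≤j → orbit-map-injective P (toℕ<n i) (toℕ<n j) i≤j e)
      , (λ j≤i → sym (orbit-map-injective P (toℕ<n j) (toℕ<n i) j≤i (sym e))) ]′ (≤-total (toℕ i) (toℕ j)))

  orbitSize-≤ : ∀ {v s t} → OrbitSize σ v s → OrbitSize σ v t → s ≤ t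
  orbitSize-≤ (f , f-inj , f-orb , _) (g , _ , _ , g-onto) = injective⇒≤ {f = λ i → proj₁ (g-onto (f i) (f-orb i))}
    λ {i} {j} e → f-inj i j (trans (proj₂ (g-onto (f i) (f-orb i))) (trans (cong g e) (sym (proj₂ (g-onto (f j) (f-orb j))))))

  orbitSize-per : ∀ {v s} → OrbitSize σ v s → per v ≡ s
  orbitSize-per {v} o = ≤-antisym (orbitSize-≤ (per-orbitSize v) o) (orbitSize-≤ o (per-orbitSize v))

  orbitSize-of : ∀ {v s} → per v ≡ s → OrbitSize σ v s
  orbitSize-of {v} refl = per-orbitSize v

  -- An orbit system from sorted representatives

  module FromLists (b : Fin m) (C F : List (Fin m)) (per-b : per b ≡ N) (3≤N : 3 ≤ N)
    (cover : ∀ u → Any (λ x → InOrbit σ x u) (b ∷ C ++ F))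
    (separate : AllPairs (λ x y → ¬ InOrbit σ x y) (b ∷ C ++ F))
    (per-C : All (λ x → 3 ≤ per x) C) (per-F : All (λ x → per x ≡ 1) F)
    (chain : AllPairs (λ x y → per x ∣ per y) C) where

    private
      rp : ℕ → Fin m
      rp = nth b (b ∷ C ++ F)

      located : ∀ u → ∃ λ i → i < length (b ∷ C ++ F) × InOrbit σ (rp i) u
      located u = nth-any (cover u)

      rank : Fin m → ℕ
      rank u = proj₁ (located u)

      coord : ∀ u → ∃ λ t → t < per (rp (rank u)) × pow σ t (rp (rank u)) ≡ u
      coord u = orbit-reduce (proj₂ (proj₂ (located u)))

      rp-C : ∀ {i} → i < length C → rp (suc i) ≡ nth b C i
      rp-C i<T = nth-++ˡ C i<T

      T≤R′ : length C ≤ length (C ++ F)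
      T≤R′ = subst (length C ≤_) (sym (length-++ C)) (m≤m+n (length C) (length F))

      separated : ∀ {i j} → i ≤ length (C ++ F) → j ≤ length (C ++ F) → InOrbit σ (rp i) (rp j) → i ≡ j
      separated {i} {j} i≤R j≤R o with <-cmp i j
      ... | tri≈ _ e _ = e
      ... | tri< i<j _ _ = contradiction o (nth-allPairs separate i<j (s≤s j≤R))
      ... | tri> _ _ j<i = contradiction (orbit-sym o) (nth-allPairs separate j<i (s≤s i≤R))

    system : OrbitSystem σ
    system = record
      { R = length (C ++ F) ; T = length C ; q = per ∘ rp ; rep = rp ; ρ = rank ; c = λ u → proj₁ (coord u)
      ; vtx-c = λ u → proj₂ (proj₂ (coord u))
      ; c<q = λ u → proj₁ (proj₂ (coord u))
      ; ρ≤R = λ u → ≤-pred (proj₁ (proj₂ (located u)))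
      ; ρ-vtx = λ {i} t i≤R → separated (≤-pred (proj₁ (proj₂ (located (pow σ t (rp i)))))) i≤R
          (orbit-trans (proj₂ (proj₂ (located (pow σ t (rp i))))) (orbit-sym (t , refl)))
      ; period = λ {i} _ → fixes (per-period (rp i))
      ; minimal = λ {i} d _ → minimal (per-period (rp i)) d
      ; T≤R = T≤R′
      ; q-fixed = λ { {suc i} (s≤s T≤i) i<R → nth-++ʳ C per-F T≤i i<R }
      ; q-chain = chain′
      ; q-top = λ {i} _ → subst (per (rp i) ∣_) (sym per-b) (per∣N (rp i))
      ; 3≤q = λ { {zero} _ → subst (3 ≤_) (sym per-b) 3≤N
                ; {suc i} i<T → subst (λ x → 3 ≤ per x) (sym (rp-C i<T)) (nth-all per-C i<T) } }
      where
      chain′ : ∀ {i j} → 1 ≤ i → i ≤ j → j ≤ length C → per (rp i) ∣ per (rp j)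
      chain′ {suc i} {suc j} _ i≤j j<T with m≤n⇒m<n∨m≡n i≤j
      ... | inj₂ refl = ∣-refl
      ... | inj₁ (s≤s i<j) = subst₂ (λ x y → per x ∣ per y) (sym (rp-C (<-trans i<j j<T))) (sym (rp-C j<T))
            (nth-allPairs chain i<j j<T)

-- Representatives by orbit size for a group of prime power order

module PrimePower {m} (σ : Permutation′ m) (p n : ℕ) (pr : Prime p) (p≢2 : p ≢ 2) 
  (co : CyclicOrder σ (p ^ suc n)) (k : ℕ → ℕ)
  (orbits : ∀ i → 1 ≤ i → i ≤ suc n → NumOrbitsOfSize σ (p ^ i) (k i)) where

  open Order co
  N = p ^ suc n
  open Periods σ N order-positive order-fixes public

  3≤p : 3 ≤ p
  3≤p = ≤∧≢⇒< (nonTrivial⇒n>1 p {{prime⇒nonTrivial pr}}) (p≢2 ∘ sym)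

  instance
    p≢0 : NonZero p
    p≢0 = prime⇒nonZero pr

  3≤p^ : ∀ {i} → 1 ≤ i → 3 ≤ p ^ i
  3≤p^ {i} 1≤i = ≤-trans 3≤p (subst (_≤ p ^ i) (^-identityʳ p) (^-monoʳ-≤ p 1≤i))

  p^-< : ∀ {i j} → i < j → p ^ i < p ^ j
  p^-< = ^-monoʳ-< p (≤-trans (s≤s (s≤s z≤n)) 3≤p)

  p^-∣ : ∀ {i j} → i ≤ j → p ^ i ∣ p ^ j
  p^-∣ {i} {j} i≤j = divides (p ^ (j ∸ i)) (trans (cong (p ^_) (sym (m∸n+n≡m i≤j))) (^-distribˡ-+-* p (j ∸ i) i))

  per-power : ∀ v → ∃ λ i → i ≤ suc n × per v ≡ p ^ i
  per-power v = ∣-prime-power pr (suc n) (per∣N v)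

  reps : ∀ i (1≤i : 1 ≤ i) (i≤n : i ≤ suc n) → Fin (k i) → Fin m
  reps i 1≤i i≤n = proj₁ (orbits i 1≤i i≤n)

  -- Without an orbit of full size all orbit sizes would divide `p ^ n`, and so would bound the
  -- order of `σ`. This provides the main orbit.
  some-regular : k (suc n) ≢ 0
  some-regular k≡0 = <⇒≱ (p^-< (n<1+n n)) (order-minimal (p ^ n) (m^n>0 p n) λ v → pow-∣-fix σ (divides-small v) (Period.fixes (per-period v)))
    where
    none : ∀ v → per v ≢ p ^ suc n
    none v e = Fin.¬Fin0 (subst Fin k≡0 (proj₁ (proj₂ (proj₂ (proj₂ (orbits (suc n) (s≤s z≤n) ≤-refl))) v (orbitSize-of e))))
    divides-small : ∀ v → per v ∣ p ^ n
    divides-small v = let i , i≤ , e = per-power v in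
      [ (λ i<sn → subst (_∣ p ^ n) (sym e) (p^-∣ (≤-pred i<sn)))
      , (λ i≡sn → contradiction (trans e (cong (p ^_) i≡sn)) (none v)) ]′ (m≤n⇒m<n∨m≡n i≤)

  Related : Fin m → Fin m → Set
  Related x y = ¬ InOrbit σ x y × per x ∣ per y

  different-size : ∀ {x y} → per x ≢ per y → ¬ InOrbit σ x y
  different-size n o = n (per-orbit o)

  related-sizes : ∀ {x y i j} → i < j → per x ≡ p ^ i → per y ≡ p ^ j → Related x y
  related-sizes i<j ex ey = different-size (λ e → <⇒≢ (p^-< i<j) (trans (sym ex) (trans e ey))) ,
    subst₂ _∣_ (sym ex) (sym ey) (p^-∣ (<⇒≤ i<j))

  -- Growing sizes make divisibility a matter of position in the list. It starts with size `p`,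
  -- since fixed points are collected in `F`.
  small : ∀ j → j ≤ suc n → List (Fin m)
  small zero    _   = []
  small (suc j) j<n = small j (<⇒≤ j<n) ++ tabulate (reps (suc j) (s≤s z≤n) j<n)

  small-per : ∀ j j≤n → All (λ x → ∃ λ i → 1 ≤ i × i ≤ j × per x ≡ p ^ i) (small j j≤n)
  small-per zero    _   = []
  small-per (suc j) j<n = All.++⁺ (All.map (λ (i , 1≤i , i≤j , e) → i , 1≤i , m≤n⇒m≤1+n i≤j , e) (small-per j (<⇒≤ j<n)))
    (All.tabulate⁺ λ a → suc j , s≤s z≤n , ≤-refl , orbitSize-per (proj₁ (proj₂ (orbits (suc j) (s≤s z≤n) j<n)) a))

  tabulate-related : ∀ {i w} {f : Fin w → Fin m} → (∀ a → per (f a) ≡ p ^ i) → (∀ a b → InOrbit σ (f a) (f b) → a ≡ b) →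
    AllPairs Related (tabulate f)
  tabulate-related size inj = AllPairs.tabulate⁺ λ {a} {b} a≢b → (λ o → a≢b (inj a b o)) ,
    subst₂ _∣_ (sym (size a)) (sym (size b)) ∣-refl

  small-related : ∀ j j≤n → AllPairs Related (small j j≤n)
  small-related zero    _   = []
  small-related (suc j) j<n = AllPairs.++⁺ (small-related j (<⇒≤ j<n))
    (tabulate-related {suc j} size (proj₁ (proj₂ (proj₂ (orbits (suc j) (s≤s z≤n) j<n)))))
    (All.map (λ (i , _ , i≤j , e) → All.tabulate⁺ λ a → related-sizes (s≤s i≤j) e (size a)) (small-per j (<⇒≤ j<n)))
    where
    size : ∀ a → per (reps (suc j) (s≤s z≤n) j<n a) ≡ p ^ suc j
    size a = orbitSize-per (proj₁ (proj₂ (orbits (suc j) (s≤s z≤n) j<n)) a)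

  small-length : ∀ j j≤n → length (small j j≤n) ≡ sum1to k j
  small-length zero    _   = refl
  small-length (suc j) j<n = trans (length-++ (small j (<⇒≤ j<n)))
    (cong₂ _+_ (small-length j (<⇒≤ j<n)) (length-tabulate (reps (suc j) (s≤s z≤n) j<n)))

  small-cover : ∀ j j≤n u i → 1 ≤ i → i ≤ j → per u ≡ p ^ i → Any (λ x → InOrbit σ x u) (small j j≤n)
  small-cover zero    _   u .0 () z≤n e
  small-cover (suc j) j<n u i 1≤i i≤sj e =
    [ (λ i<sj → Any.++⁺ˡ (small-cover j (<⇒≤ j<n) u i 1≤i (≤-pred i<sj) e))
    , (λ i≡sj → let a , o = proj₂ (proj₂ (proj₂ (orbits (suc j) (s≤s z≤n) j<n))) u (orbitSize-of (trans e (cong (p ^_) i≡sj)))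
                in Any.++⁺ʳ (small j (<⇒≤ j<n)) (Any.tabulate⁺ a o)) ]′ (m≤n⇒m<n∨m≡n i≤sj)

  fixed? : ∀ x → Dec (per x ≡ 1)
  fixed? x = per x ≟ 1

  F : List (Fin m)
  F = filter fixed? (allFin m)

  F-separate : AllPairs (λ x y → ¬ InOrbit σ x y) F
  F-separate = allPairs-with {P = λ x → per x ≡ 1} (λ {x} e _ x≢y (t , y≡) → x≢y (sym (trans y≡
      (pow-∣-fix σ (subst (_∣ t) (sym e) (1∣ t)) (Period.fixes (per-period x))))))
    (All.all-filter fixed? (allFin m)) (Unique.filter⁺ fixed? (Unique.allFin⁺ m))

  module Top {w} (k≡ : k (suc n) ≡ suc w) where

    top : NumOrbitsOfSize σ N (suc w)
    top = subst (NumOrbitsOfSize σ N) k≡ (orbits (suc n) (s≤s z≤n) ≤-refl)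

    t : Fin (suc w) → Fin m
    t = proj₁ top

    size : ∀ a → per (t a) ≡ N
    size a = orbitSize-per (proj₁ (proj₂ top) a)

    t-injective : ∀ a b → InOrbit σ (t a) (t b) → a ≡ b
    t-injective = proj₁ (proj₂ (proj₂ top))

    low : List (Fin m)
    low = small n (n≤1+n n)

    -- Of the orbits of full size, `t zero` is set apart as the main orbit and the others close the
    -- list.
    C : List (Fin m)
    C = low ++ tabulate (t ∘ suc)

    C-related : AllPairs Related C
    C-related = AllPairs.++⁺ (small-related n (n≤1+n n))
      (tabulate-related {suc n} (size ∘ suc) λ a b o → Fin.suc-injective (t-injective _ _ o))
      (All.map (λ (i , _ , i≤n , e) → All.tabulate⁺ λ a → related-sizes (s≤s i≤n) e (size (suc a))) (small-per n (n≤1+n n)))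

    C-per : All (λ x → ∃ λ i → 1 ≤ i × per x ≡ p ^ i) C
    C-per = All.++⁺ (All.map (λ (i , 1≤i , _ , e) → i , 1≤i , e) (small-per n (n≤1+n n)))
      (All.tabulate⁺ λ a → suc n , s≤s z≤n , size (suc a))

    C-big : All (λ x → 3 ≤ per x) C
    C-big = All.map (λ (i , 1≤i , e) → subst (3 ≤_) (sym e) (3≤p^ 1≤i)) C-per

    F-small : All (λ x → per x ≡ 1) F
    F-small = All.all-filter fixed? (allFin m)

    big-small : ∀ {x} → 3 ≤ per x → All (λ y → ¬ InOrbit σ x y) F
    big-small 3≤ = All.map (λ e → different-size λ e′ → <⇒≱ (s≤s (s≤s z≤n)) (subst (3 ≤_) (trans e′ e) 3≤)) F-small

    b-separate : All (λ y → ¬ InOrbit σ (t zero) y) (C ++ F)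
    b-separate = All.++⁺ (All.++⁺
      (All.map (λ (i , _ , i≤n , e) → different-size λ e′ → <⇒≢ (p^-< (s≤s i≤n)) (trans (sym e) (trans (sym e′) (size zero)))) (small-per n (n≤1+n n)))
      (All.tabulate⁺ λ a o → Fin.0≢1+n (t-injective zero (suc a) o)))
      (big-small (subst (3 ≤_) (sym (size zero)) (3≤p^ {suc n} (s≤s z≤n))))

    separate : AllPairs (λ x y → ¬ InOrbit σ x y) (t zero ∷ C ++ F)
    separate = b-separate ∷ AllPairs.++⁺ (AllPairs.map proj₁ C-related) F-separate (All.map big-small C-big)

    cover-top : ∀ {u} → (∃ λ a → InOrbit σ (t a) u) → Any (λ x → InOrbit σ x u) (t zero ∷ C ++ F)
    cover-top (zero  , o) = here o
    cover-top (suc a , o) = there (Any.++⁺ˡ (Any.++⁺ʳ low (Any.tabulate⁺ a o)))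

    cover-power : ∀ {u} i → i ≤ suc n → per u ≡ p ^ i → Any (λ x → InOrbit σ x u) (t zero ∷ C ++ F)
    cover-power {u} zero    _    e = there (Any.++⁺ʳ C (Any.map (λ { refl → 0 , refl }) (∈-filter⁺ fixed? (∈-allFin u) e)))
    cover-power {u} (suc i) i<sn e =
      [ (λ i<n → there (Any.++⁺ˡ (Any.++⁺ˡ (small-cover n (n≤1+n n) u (suc i) (s≤s z≤n) (≤-pred i<n) e))))
      , (λ i≡n → cover-top (proj₂ (proj₂ (proj₂ top)) u (orbitSize-of (trans e (cong (p ^_) i≡n)))))
      ]′ (m≤n⇒m<n∨m≡n i<sn)

    cover : ∀ u → Any (λ x → InOrbit σ x u) (t zero ∷ C ++ F)
    cover u = let i , i≤n , e = per-power u in cover-power i i≤n e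

    open FromLists (t zero) C F (size zero) (3≤p^ {suc n} (s≤s z≤n)) cover separate C-big F-small
      (AllPairs.map proj₂ C-related) public using (system)

    open OrbitSystem system using (T; q)

    T≡ : sum1to k (suc n) ≡ suc T
    T≡ = trans (cong (sum1to k n +_) k≡) (trans (+-suc (sum1to k n) w) (cong suc (sym (trans (length-++ low)
      (cong₂ _+_ (small-length n (n≤1+n n)) (length-tabulate (t ∘ suc)))))))

    q0≡ : q 0 ≡ N
    q0≡ = size zero

-- Numerical estimates for the distance bound

odd-prime-power : ∀ {p} → Prime p → p ≢ 2 → ∀ n → ¬ 2 ∣ p ^ n
odd-prime-power pr p≢2 zero    d = contradiction (∣1⇒≡1 d) λ ()
odd-prime-power pr p≢2 (suc n) d with euclidsLemma _ _ prime[2] d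
... | inj₂ d′ = odd-prime-power pr p≢2 n d′
... | inj₁ 2∣p with prime⇒irreducible pr 2∣p
... | inj₁ ()
... | inj₂ 2≡p = p≢2 (sym 2≡p)

-- Oddness excludes `4 * (N / 4)` being equal to `N`, and already `8 ≤ N` makes the quotient at
-- least 2.
quarter : ∀ N → 9 ≤ N → ¬ 2 ∣ N → 2 ≤ N / 4 × 4 * (N / 4) < N × N ≤ 4 * (N / 4) + 3
quarter N 9≤N odd = /-monoˡ-≤ 4 (≤-trans (n≤1+n 8) 9≤N) ,
    ≤∧≢⇒< (subst (4 * K ≤_) (sym N≡) (m≤m+n (4 * K) (N % 4))) (λ e → odd (divides (2 * K) (trans (sym e) (trans (*-assoc 2 2 K) (*-comm 2 (2 * K)))))) ,
    subst (_≤ 4 * K + 3) (sym N≡) (+-monoʳ-≤ (4 * K) (≤-pred (m%n<n N 4)))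
  where
  K = N / 4
  N≡ : N ≡ 4 * K + N % 4
  N≡ = trans (m≡m%n+[m/n]*n N 4) (trans (+-comm (N % 4) (K * 4)) (cong (_+ N % 4) (*-comm K 4)))

-- From `2K ≤ 3M` would follow `14K ≤ 21M ≤ 3N ≤ 12K + 9`, so `2K ≤ 9` and `N ≤ 21`. The factor 7
-- falls short of the 9 that `few₁` would ask for, and the size of `N` compensates.
few₂ : ∀ {N K M} → N ≤ 4 * K + 3 → 49 ≤ N → 7 * M ≤ N → 3 * M < K + K
few₂ {N} {K} {M} N≤ 49≤N 7M≤N = ≰⇒> λ 2K≤3M → <⇒≱ (≤ᵇ⇒≤ 22 49 _) (≤-trans 49≤N (begin
    N                ≤⟨ N≤ ⟩
    4 * K + 3        ≡⟨ cong (_+ 3) (*-assoc 2 2 K) ⟩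
    2 * (2 * K) + 3  ≤⟨ +-monoˡ-≤ 3 (*-monoʳ-≤ 2 (2K≤9 2K≤3M)) ⟩
    21               ∎))
  where
  open ≤-Reasoning
  2K≤9 : K + K ≤ 3 * M → 2 * K ≤ 9
  2K≤9 2K≤3M = +-cancelˡ-≤ (12 * K) (2 * K) 9 (begin
    12 * K + 2 * K     ≡⟨ sym (*-distribʳ-+ K 12 2) ⟩
    14 * K             ≡⟨ *-assoc 7 2 K ⟩
    7 * (2 * K)        ≡⟨ cong (λ y → 7 * (K + y)) (+-identityʳ K) ⟩
    7 * (K + K)        ≤⟨ *-monoʳ-≤ 7 2K≤3M ⟩
    7 * (3 * M)        ≡⟨ trans (sym (*-assoc 7 3 M)) (*-assoc 3 7 M) ⟩
    3 * (7 * M)        ≤⟨ *-monoʳ-≤ 3 (≤-trans 7M≤N N≤) ⟩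
    3 * (4 * K + 3)    ≡⟨ *-distribˡ-+ 3 (4 * K) 3 ⟩
    3 * (4 * K) + 9    ≡⟨ cong (_+ 9) (sym (*-assoc 3 4 K)) ⟩
    12 * K + 9         ∎)

prime-≥7 : ∀ {p} → Prime p → 3 ≤ p → p ≢ 3 → p ≢ 5 → 7 ≤ p
prime-≥7 {p} pr 3≤p p≢3 p≢5 = ≤∧≢⇒< (≤∧≢⇒< (≤∧≢⇒< (≤∧≢⇒< 3≤p (p≢3 ∘ sym)) (λ { refl → from-no (prime? 4) pr })) (p≢5 ∘ sym))
  (λ { refl → from-no (prime? 6) pr })

k₁≤sum : ∀ (k : ℕ → ℕ) n → k 1 ≤ sum1to k (suc n)
k₁≤sum k zero    = ≤-refl
k₁≤sum k (suc n) = ≤-trans (k₁≤sum k n) (m≤m+n _ _)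

-- The cases by the number of nontrivial orbits

module Cases {m} (σ : Permutation′ m) (p n : ℕ) (pr : Prime p) (p≢2 : p ≢ 2)
  (co : CyclicOrder σ (p ^ suc (suc n))) (k : ℕ → ℕ)
  (orbits : ∀ i → 1 ≤ i → i ≤ suc (suc n) → NumOrbitsOfSize σ (p ^ i) (k i))
  {w} (k≡ : k (suc (suc n)) ≡ suc w) where

  open PrimePower σ p (suc n) pr p≢2 co k orbits
  open Top k≡ using (system; T≡; q0≡)
  open OrbitSystem system using (T; q; ρ; rep; vtx-c; T≤R; q-fixed; 3≤q; c; ρ≤R; ρ-vtx)

  square≤ : ∀ {a} → a ≤ p → a * a ≤ N
  square≤ {a} a≤p = *-mono-≤ a≤p (≤-trans a≤p (subst (_≤ p ^ suc n) (^-identityʳ p) (^-monoʳ-≤ p {1} {suc n} (s≤s z≤n))))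

  K : ℕ
  K = N / 4

  private
    quarters = quarter N (square≤ 3≤p) (odd-prime-power pr p≢2 (suc (suc n)))

    N≤ : q 0 ≤ 4 * K + 3
    N≤ = subst (_≤ 4 * K + 3) (sym q0≡) (proj₂ (proj₂ quarters))

    module Positive = Rotations system K (proj₁ quarters) (subst (4 * K <_) (sym q0≡) (proj₁ (proj₂ quarters))) N≤

  q-ρ : ∀ u → q (ρ u) ≡ per u
  q-ρ u = trans (sym (per-pow (c u) (rep (ρ u)))) (cong per (vtx-c u))

  single : sum1to k (suc (suc n)) ≡ 1 → ¬ InGRany σ
  single e = NonMembership.single-orbit system (suc-injective (trans (sym T≡) e))

  many : 2 < sum1to k (suc (suc n)) → InGR 2 σ
  many lt = Positive.many-orbits (≤-trans (s≤s z≤n) 2≤T) 2≤T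
    where
    2≤T : 2 ≤ T
    2≤T = ≤-pred (subst (2 <_) T≡ lt)

  module Two (sum≡2 : sum1to k (suc (suc n)) ≡ 2) where

    T≡1 : T ≡ 1
    T≡1 = suc-injective (trans (sym T≡) sum≡2)

    1≤T : 1 ≤ T
    1≤T = ≤-reflexive (sym T≡1)

    three : InGR 3 σ
    three = Positive.three-colours 1≤T

    -- An orbit of size `p` is neither the main orbit, which is larger, nor a fixed point; with `T`
    -- equal to 1 only rank 1 is left.
    q₁≡p : k 1 ≢ 0 → q 1 ≡ p
    q₁≡p k₁≢0 = trans (cong q (sym ρv≡1)) (trans (q-ρ v) per-v)
      where
      orb = orbits 1 (s≤s z≤n) (s≤s z≤n)
      a : Fin (k 1)
      a = subst Fin (suc-pred (k 1) {{≢-nonZero k₁≢0}}) zero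
      v = proj₁ orb a
      per-v : per v ≡ p
      per-v = trans (orbitSize-per (proj₁ (proj₂ orb) a)) (^-identityʳ p)
      ρv≤T : ρ v ≤ T
      ρv≤T = ≮⇒≥ λ T<ρ → <⇒≱ (s≤s (s≤s z≤n)) (subst (3 ≤_) (trans (sym per-v) (trans (sym (q-ρ v)) (q-fixed T<ρ (ρ≤R v)))) 3≤p)
      ρv≢0 : ρ v ≢ 0
      ρv≢0 e = <⇒≢ (p^-< {1} {suc (suc n)} (s≤s (s≤s z≤n))) (trans (^-identityʳ p) (trans (sym per-v) (trans (sym (q-ρ v)) (trans (cong q e) q0≡))))
      ρv≡1 : ρ v ≡ 1
      ρv≡1 = ≤-antisym (subst (ρ v ≤_) T≡1 ρv≤T) (n≢0⇒n>0 ρv≢0)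

    not-two : k 1 ≢ 0 → p ≡ 3 ⊎ p ≡ 5 → ¬ InGR 2 σ
    not-two k₁≢0 (inj₁ p≡3) = NonMembership.symmetric-pair system T≡1 (trans (q₁≡p k₁≢0) p≡3) has-centre₃
    not-two k₁≢0 (inj₂ p≡5) = NonMembership.symmetric-pair system T≡1 (trans (q₁≡p k₁≢0) p≡5) has-centre₅

    two-if-9 : 9 ≤ q 1 → InGR 2 σ
    two-if-9 9≤q = Positive.two-orbits 1≤T T≡1 (≤-trans (s≤s (s≤s (s≤s (s≤s (s≤s (s≤s (s≤s z≤n))))))) 9≤q)
      λ M e → Positive.few₁ 1≤T (subst₂ _≤_ (trans (*-comm M 9) (*-assoc 3 3 M)) (sym e) (*-monoʳ-≤ M 9≤q))

    two-if-7 : q 1 ≡ p → 7 ≤ p → InGR 2 σ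
    two-if-7 q≡p 7≤p = Positive.two-orbits 1≤T T≡1 7≤q
      λ M e → few₂ {q 0} {K} {M} N≤ (subst (49 ≤_) (sym q0≡) (square≤ 7≤p)) (subst₂ _≤_ (*-comm M 7) (sym e) (*-monoʳ-≤ M 7≤q))
      where
      7≤q : 7 ≤ q 1
      7≤q = subst (7 ≤_) (sym q≡p) 7≤p

    k₁-cases : k 1 ≢ 0 → k 1 ≡ 1 ⊎ k 1 ≡ 2
    k₁-cases k₁≢0 with m≤n⇒m<n∨m≡n (subst (k 1 ≤_) sum≡2 (k₁≤sum k (suc n)))
    ... | inj₂ e = inj₂ e
    ... | inj₁ (s≤s k₁≤1) = inj₁ (≤-antisym k₁≤1 (n≢0⇒n>0 k₁≢0))

    -- The second orbit has size `p ^ i` with `i` positive. From `i` = 2 on this is at least 9 for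
    -- every odd `p`; for `i` = 1 the number `k 1` is positive, and the excluded primes leave `p` at
    -- least 7.
    two : ¬ ((k 1 ≡ 1 ⊎ k 1 ≡ 2) × (p ≡ 3 ⊎ p ≡ 5)) → InGR 2 σ
    two exc = go (proj₁ i) (proj₂ (proj₂ i))
      where
      i = per-power (rep 1)
      go : ∀ i → per (rep 1) ≡ p ^ i → InGR 2 σ
      go zero e = contradiction (subst (3 ≤_) e (3≤q 1≤T)) λ { (s≤s ()) }
      go (suc zero) e = two-if-7 q≡p (prime-≥7 pr 3≤p (λ p≡3 → exc (k₁-cases k₁≢0 , inj₁ p≡3)) (λ p≡5 → exc (k₁-cases k₁≢0 , inj₂ p≡5)))
        where
        q≡p : q 1 ≡ p
        q≡p = trans e (^-identityʳ p)
        k₁≢0 : k 1 ≢ 0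
        k₁≢0 k₁≡0 = Fin.¬Fin0 (subst Fin k₁≡0 (proj₁ (proj₂ (proj₂ (proj₂ (orbits 1 (s≤s z≤n) (s≤s z≤n)))) (rep 1) (orbitSize-of e))))
      go (suc (suc i)) e = two-if-9 (subst (9 ≤_) (sym e) (≤-trans (*-mono-≤ 3≤p 3≤p)
        (subst (_≤ p ^ suc (suc i)) (cong (p *_) (^-identityʳ p)) (^-monoʳ-≤ p {2} {suc (suc i)} (s≤s (s≤s z≤n))))))

theorem4p5 : (p n m : ℕ) → Prime p → p ≢ 2 → 2 ≤ n →
    (σ : Permutation′ m) → CyclicOrder σ (p ^ n) →
    (k : ℕ → ℕ) → (∀ i → 1 ≤ i → i ≤ n → NumOrbitsOfSize σ (p ^ i) (k i)) →
    (sum1to k n ≡ 1 → ¬ InGRany σ) ×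
    (sum1to k n ≡ 2 →
    (((k 1 ≡ 1 ⊎ k 1 ≡ 2) × (p ≡ 3 ⊎ p ≡ 5)) → InGRstar 3 σ) ×
    (¬ ((k 1 ≡ 1 ⊎ k 1 ≡ 2) × (p ≡ 3 ⊎ p ≡ 5)) → InGR 2 σ)) ×
    (2 < sum1to k n → InGR 2 σ)
theorem4p5 p (suc (suc n)) m pr p≢2 (s≤s (s≤s z≤n)) σ co k orbits =
  single , (λ e → (λ (k₁ , p∈) → Two.three e , Two.not-two e (k₁≢0 k₁) p∈) , Two.two e) , many
  where
  kₙ≢0 : k (suc (suc n)) ≢ 0
  kₙ≢0 = PrimePower.some-regular σ p (suc n) pr p≢2 co k orbits
  open Cases σ p n pr p≢2 co k orbits (sym (suc-pred (k (suc (suc n))) {{≢-nonZero kₙ≢0}}))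
  k₁≢0 : k 1 ≡ 1 ⊎ k 1 ≡ 2 → k 1 ≢ 0
  k₁≢0 (inj₁ e) e₀ = contradiction (trans (sym e) e₀) λ ()
  k₁≢0 (inj₂ e) e₀ = contradiction (trans (sym e) e₀) λ ()
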